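{- We have $$A^{1324}(x,q)=1+I^{1324}(x,q)+I^{132}(x,q)\left(A^{213}(x,q)-1\right).$$ Also, $$I^{1324}(x)=A^{1324}(x)-1-(1-x)\left(C(x)-1\right)^2.$$ Moreover, $I^{1324}_1=1$ and for $n\ge2$, $$I^{1324}_n=A^{1324}_n-C_{n+1}+3C_n-2C_{n-1},$$ where $C_m=\frac1{m+1}\binom{2m}m$ is the $m$-th Catalan number and $C(x)=\sum_{m\ge0}C_mx^m=\frac{1-\sqrt{1-4x}}{2x}$.
   Context: For a permutation $\pi=\pi_1\cdots\pi_n$ of $[n]$, let $i_\pi$ be the smallest index $i$ with $\{\pi_1,\dots,\pi_i\}=\{1,\dots,i\}$; $\pi$ is indecomposable if $i_\pi=n$ (the empty permutation is not indecomposable). A permutation $\pi$ avoids a pattern $\tau\in\mathfrak S_k$ if no subsequence $\pi_{j_1}\cdots\pi_{j_k}$ ($j_1<\cdots<j_k$) is order-isomorphic to $\tau$. A descent of $\pi$ is an index $i$ with $\pi_i>\pi_{i+1}$. For a pattern $\sigma$, $A^\sigma_{n,i}$ (resp. $I^\sigma_{n,i}$) is the number of $\sigma$-avoiding permutations (resp. $\sigma$-avoiding indecomposable permutations) of $[n]$ with $i$ descents; $A^\sigma_n=\sum_iA^\sigma_{n,i}$ ($A^\sigma_0=1$), $I^\sigma_n=\sum_iI^\sigma_{n,i}$; $A^\sigma(x,q)=1+\sum_{n\ge1}\sum_iA^\sigma_{n,i}x^nq^i$, $I^\sigma(x,q)=\sum_{n\ge1}\sum_iI^\sigma_{n,i}x^nq^i$,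 $A^\sigma(x)=A^\sigma(x,1)$, $I^\sigma(x)=I^\sigma(x,1)$. -}

module Defs where

open import Data.Nat as ℕ using (ℕ; zero; suc; _<ᵇ_; _≡ᵇ_; _≤ᵇ_)
open import Data.Nat.DivMod using (_/_)
open import Data.Nat.Combinatorics using (_C_)
open import Data.Integer as ℤ using (ℤ; +_)
open import Data.Bool using (Bool; true; false; _∧_; _∨_; not; if_then_else_)
open import Data.List using (List; []; _∷_; map; _++_; concatMap; length; filter; zipWith; take; upTo)
open import Data.Bool.ListAction using (any; all; and)
open import Relation.Nullary.Decidable using (T?)

range1 : ℕ → List ℕ
range1 n = map suc (upTo n)

elem : ℕ → List ℕ → Bool
elem v w = any (λ x → v ≡ᵇ x) w

words : ℕ → ℕ → List (List ℕ)
words zero    n = [] ∷ []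
words (suc k) n = concatMap (λ v → map (v ∷_) (words k n)) (range1 n)

-- a word of length n over [1..n] is a permutation of [n] iff every
-- element of [1..n] occurs in it
isPermOf : ℕ → List ℕ → Bool
isPermOf n w = all (λ v → elem v w) (range1 n)

perms : ℕ → List (List ℕ)
perms n = filter (λ w → T? (isPermOf n w)) (words n n)

subseqs : {A : Set} → ℕ → List A → List (List A)
subseqs zero    xs       = [] ∷ []
subseqs (suc k) []       = []
subseqs (suc k) (x ∷ xs) = map (x ∷_) (subseqs k xs) ++ subseqs (suc k) xs

sameCmp : ℕ → ℕ → ℕ → ℕ → Bool
sameCmp x x' y y' = ((x <ᵇ x') ≡ᵇB (y <ᵇ y')) ∧ ((x' <ᵇ x) ≡ᵇB (y' <ᵇ y))
  where
  _≡ᵇB_ : Bool → Bool → Bool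
  true  ≡ᵇB b = b
  false ≡ᵇB b = not b

orderIso : List ℕ → List ℕ → Bool
orderIso []       []       = true
orderIso (x ∷ xs) (y ∷ ys) = and (zipWith (λ x' y' → sameCmp x x' y y') xs ys) ∧ orderIso xs ys
orderIso _        _        = false

contains : List ℕ → List ℕ → Bool
contains τ π = any (λ s → orderIso s τ) (subseqs (length τ) π)

avoids : List ℕ → List ℕ → Bool
avoids τ π = not (contains τ π)

des : List ℕ → ℕ
des (x ∷ y ∷ r) = (if y <ᵇ x then 1 else 0) ℕ.+ des (y ∷ r)
des _           = 0

prefixIsInitial : ℕ → List ℕ → Bool
prefixIsInitial i π =
  all (λ v → elem v (range1 i)) (take i π) ∧ all (λ v → elem v (take i π)) (range1 i)

indec : List ℕ → Bool
indec []      = false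
indec (x ∷ π) = not (any (λ i → prefixIsInitial i (x ∷ π)) (range1 (length π)))

count : (List ℕ → Bool) → List (List ℕ) → ℕ
count p xs = length (filter (λ w → T? (p w)) xs)

A : List ℕ → ℕ → ℕ → ℕ
A σ n i = count (λ π → avoids σ π ∧ (des π ≡ᵇ i)) (perms n)

I : List ℕ → ℕ → ℕ → ℕ
I σ n i = count (λ π → avoids σ π ∧ indec π ∧ (des π ≡ᵇ i)) (perms n)

sumTo : ℕ → (ℕ → ℕ) → ℕ
sumTo zero    f = f 0
sumTo (suc n) f = sumTo n f ℕ.+ f (suc n)

-- A^σ_n = Σ_i A^σ_{n,i}  (a permutation of [n] has at most n descents,
-- so summing over 0 ≤ i ≤ n is the full sum)
Aₙ : List ℕ → ℕ → ℕ
Aₙ σ n = sumTo n (A σ n)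

Iₙ : List ℕ → ℕ → ℕ
Iₙ σ n = sumTo n (I σ n)

catalan : ℕ → ℕ
catalan m = ((2 ℕ.* m) C m) / suc m

-- univariate: f n = [xⁿ] f
FPS : Set
FPS = ℕ → ℤ

-- bivariate: F n i = [xⁿ qⁱ] F
FPS2 : Set
FPS2 = ℕ → ℕ → ℤ

sumZ : ℕ → (ℕ → ℤ) → ℤ
sumZ zero    f = f 0
sumZ (suc n) f = sumZ n f ℤ.+ f (suc n)

infixl 6 _⊕_ _⊖_ _⊕₂_ _⊖₂_
infixl 7 _⊛_ _⊛₂_

_⊕_ _⊖_ _⊛_ : FPS → FPS → FPS
(f ⊕ g) n = f n ℤ.+ g n
(f ⊖ g) n = f n ℤ.- g n
(f ⊛ g) n = sumZ n (λ k → f k ℤ.* g (n ℕ.∸ k))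

oneS : FPS
oneS zero    = + 1
oneS (suc n) = + 0

xS : FPS
xS 1 = + 1
xS _ = + 0

_⊕₂_ _⊖₂_ _⊛₂_ : FPS2 → FPS2 → FPS2
(F ⊕₂ G) n i = F n i ℤ.+ G n i
(F ⊖₂ G) n i = F n i ℤ.- G n i
(F ⊛₂ G) n i = sumZ n (λ k → sumZ i (λ j → F k j ℤ.* G (n ℕ.∸ k) (i ℕ.∸ j)))

oneS2 : FPS2
oneS2 zero zero = + 1
oneS2 _    _    = + 0

-- A^σ(x,q) = 1 + Σ_{n≥1} Σ_i A^σ_{n,i} xⁿ qⁱ  (A^σ_{0,0} = 1 already)
Agf : List ℕ → FPS2
Agf σ n i = + A σ n i

-- I^σ(x,q) = Σ_{n≥1} Σ_i I^σ_{n,i} xⁿ qⁱ  (I^σ_{0,i} = 0 already)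
Igf : List ℕ → FPS2
Igf σ n i = + I σ n i

-- A^σ(x) = A^σ(x,1), I^σ(x) = I^σ(x,1)
Agf1 : List ℕ → FPS
Agf1 σ n = + Aₙ σ n

Igf1 : List ℕ → FPS
Igf1 σ n = + Iₙ σ n

Cgf : FPS
Cgf m = + catalan m

p1324 p132 p213 : List ℕ
p1324 = 1 ∷ 3 ∷ 2 ∷ 4 ∷ []
p132  = 1 ∷ 3 ∷ 2 ∷ []
p213  = 2 ∷ 1 ∷ 3 ∷ []

{-# OPTIONS --safe #-}

-- Write a decomposable permutation as α ⊕ β, where α is its first indecomposable component. Such a sum
-- avoids 1324 iff α avoids 132 and β avoids 213, because a 132 in α is completed by any entry of β and
-- a 213 in β by any entry of α. Descents add up, which gives the bivariate identity.
--
-- For q = 1, splitting a 132-avoider at its maximum gives the Catalan recurrence, and reverse-complement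
-- transfers the count to 213. A decomposable 132-avoider ends with its maximum, so
-- I^132(x) = (1 − x)(C(x) − 1). The coefficient formula then follows from C = 1 + x C².

module Submission where

open import Defs
open import Data.Bool using (Bool; true; false; T; not; _∧_; if_then_else_)
open import Data.Bool.ListAction using (and; any; all)
open import Data.Bool.Properties using (T-∧; T-≡; T-not-≡; ∧-assoc; ∧-identityʳ)
open import Data.Empty using (⊥-elim)
open import Data.List hiding (find; lookup; _∷ʳ_; and; or; any; all)
open import Data.List.Properties
open import Data.List.Membership.Propositional using (_∈_; _∉_; find; lose)
open import Data.List.Membership.Propositional.Properties
open import Data.List.Relation.Binary.Permutation.Propositional hiding (trans)
open import Data.List.Relation.Binary.Permutation.Propositional.Properties
  using (↭-length; ∈-resp-↭; drop-∷; shift; ↭-map-inv; ↭-reverse; ++-comm)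
  renaming (map⁺ to ↭-map⁺; ++⁺ to ↭-++⁺; ++⁺ʳ to ↭-++⁺ʳ)
import Data.List.Relation.Binary.Permutation.Setoid.Properties as SetoidPermutation
open import Data.List.Relation.Binary.Pointwise using (Pointwise; []; _∷_)
open import Data.List.Relation.Binary.Sublist.Propositional
  using (_⊆_; []; _∷_; _∷ʳ_; ⊆-refl; ⊆-trans; from∈; minimum; lookup)
import Data.List.Relation.Binary.Sublist.Propositional.Properties as Sublist
open import Data.List.Relation.Unary.All as All using (All; []; _∷_)
import Data.List.Relation.Unary.All.Properties as All
open import Data.List.Relation.Unary.AllPairs using ([]; _∷_)
open import Data.List.Relation.Unary.Any as Any using (here; there)
import Data.List.Relation.Unary.Any.Properties as Any
open import Data.List.Relation.Unary.Unique.Propositional using (Unique)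
import Data.List.Relation.Unary.Unique.Propositional.Properties as Unique
open import Data.Nat as ℕ using (ℕ; zero; suc; pred; _≥_; _∸_; z≤n; s≤s)
open import Data.Nat.Induction using (Acc; acc; <-wellFounded)
open import Data.Nat.Properties
open import Data.Product using (∃; ∃₂; _×_; _,_; proj₁; proj₂; uncurry)
open import Data.Sum using (_⊎_; inj₁; inj₂; [_,_]′)
open import Function using (_∘_)
open import Function.Bundles using (Equivalence; _⇔_; mk⇔)
open import Relation.Binary.Definitions using (tri<; tri≈; tri>)
open import Relation.Binary.PropositionalEquality hiding ([_])
open import Relation.Nullary using (¬_; yes; no; contradiction)
open import Relation.Nullary.Decidable using (T?)

open Equivalence

-- The statement defines `catalan` as a rounded quotient of a binomial coefficient, whereas counting
-- 132-avoiders produces the convolution recurrence. Bridging the two takes purely arithmetic work: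
-- exactness of the division, a first-order recurrence for the closed form, and a symmetrisation of
-- the convolution showing that it obeys a recurrence with the same solution.
--
-- Cutting at the first component, rather than at an arbitrary place, is what makes the sum
-- decomposition unique; a permutation with several components would otherwise be counted once per
-- cut. The subtracted 1 in the factor of 213-avoiders records that the second summand is nonempty.
--
-- Each enumeration is a bijection between duplicate-free lists, and a permutation of [n] is handled
-- as a list related by `↭` to `range1 n`. Identities with minus signs are first proved additively
-- over the natural numbers; integers enter only when the series are assembled.

private variable
  X Y : Set

-- Catalan numbers: from the binomial formula to the convolution recurrence.

module CatalanNumbers where

  open import Data.Nat
  open import Data.Nat.Tactic.RingSolver using (solve-∀)
  open import Data.Nat.Combinatorics using (_C_; nCk≡n!/k![n-k]!; k![n∸k]!∣n!)
  open import Data.Nat.DivMod using (m/n*n≡m; m*n/n≡m)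

  -- Writing the upper index as a sum keeps truncated subtraction out of the later recurrences,
  -- which then follow by cancelling factorials.
  +-C-* : ∀ m n → ((m + n) C m) * (m ! * n !) ≡ (m + n) !
  +-C-* m n = begin
    ((m + n) C m) * (m ! * n !)
      ≡⟨ cong₂ (λ x k → x * (m ! * k !)) (nCk≡n!/k![n-k]! (m≤m+n m n)) (sym (m+n∸m≡n m n)) ⟩
    (((m + n) !) / (m ! * (m + n ∸ m) !)) * (m ! * (m + n ∸ m) !)
      ≡⟨ m/n*n≡m (k![n∸k]!∣n! (m≤m+n m n)) ⟩
    (m + n) ! ∎
    where
    open ≡-Reasoning
    instance _ = m !* (m + n ∸ m) !≢0

  -- Multiplied by `m ! * n !`, both sides become `(suc m + n) !`.
  sucˡ-C : ∀ m n → suc m * ((suc m + n) C suc m) ≡ suc (m + n) * ((m + n) C m)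
  sucˡ-C m n = *-cancelʳ-≡ _ _ (m ! * n !) (begin
    suc m * ((suc m + n) C suc m) * (m ! * n !)   ≡⟨ lhs (suc m) ((suc m + n) C suc m) (m !) (n !) ⟩
    ((suc m + n) C suc m) * (suc m ! * n !)       ≡⟨ +-C-* (suc m) n ⟩
    suc (m + n) * (m + n) !                       ≡⟨ cong (suc (m + n) *_) (+-C-* m n) ⟨
    suc (m + n) * (((m + n) C m) * (m ! * n !))   ≡⟨ *-assoc (suc (m + n)) ((m + n) C m) (m ! * n !) ⟨
    suc (m + n) * ((m + n) C m) * (m ! * n !)     ∎)
    where
    open ≡-Reasoning
    instance _ = m !* n !≢0
    lhs : ∀ a b c d → a * b * (c * d) ≡ b * (a * c * d)
    lhs = solve-∀

  sucʳ-C : ∀ m n → suc n * ((m + suc n) C m) ≡ suc (m + n) * ((m + n) C m)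
  sucʳ-C m n = *-cancelʳ-≡ _ _ (m ! * n !) (begin
    suc n * ((m + suc n) C m) * (m ! * n !)       ≡⟨ lhs (suc n) ((m + suc n) C m) (m !) (n !) ⟩
    ((m + suc n) C m) * (m ! * suc n !)           ≡⟨ +-C-* m (suc n) ⟩
    (m + suc n) !                                 ≡⟨ cong _! (+-suc m n) ⟩
    suc (m + n) * (m + n) !                       ≡⟨ cong (suc (m + n) *_) (+-C-* m n) ⟨
    suc (m + n) * (((m + n) C m) * (m ! * n !))   ≡⟨ *-assoc (suc (m + n)) ((m + n) C m) (m ! * n !) ⟨
    suc (m + n) * ((m + n) C m) * (m ! * n !)     ∎)
    where
    open ≡-Reasoning
    instance _ = m !* n !≢0
    lhs : ∀ a b c d → a * b * (c * d) ≡ b * (c * (a * d))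
    lhs = solve-∀

  -- Each half of the central index is raised once. The two steps contribute (2n+2)(2n+1), which is
  -- (n+1)(4n+2), and the extra factor n+1 cancels.
  centralBinomial-suc : ∀ n → suc n * ((suc n + suc n) C suc n) ≡ (4 * n + 2) * ((n + n) C n)
  centralBinomial-suc n = *-cancelˡ-≡ _ _ (suc n) (begin
    suc n * (suc n * ((suc n + suc n) C suc n))         ≡⟨ cong (suc n *_) (sucˡ-C n (suc n)) ⟩
    suc n * (suc (n + suc n) * ((n + suc n) C n))       ≡⟨ exchange (suc n) (suc (n + suc n)) _ ⟩
    suc (n + suc n) * (suc n * ((n + suc n) C n))       ≡⟨ cong (suc (n + suc n) *_) (sucʳ-C n n) ⟩
    suc (n + suc n) * (suc (n + n) * ((n + n) C n))     ≡⟨ rhs n _ ⟩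
    suc n * ((4 * n + 2) * ((n + n) C n))               ∎)
    where
    open ≡-Reasoning
    exchange : ∀ a b c → a * (b * c) ≡ b * (a * c)
    exchange = solve-∀
    rhs : ∀ n c → suc (n + suc n) * (suc (n + n) * c) ≡ suc n * ((4 * n + 2) * c)
    rhs = solve-∀

  -- The quotient is C(2n, n) ∸ C(2n, n + 1).
  centralBinomial-multiple : ∀ n → ∃ λ c → (n + n) C n ≡ c * suc n
  centralBinomial-multiple zero = 1 , refl
  centralBinomial-multiple (suc n) = b ∸ a , sym (begin
    (b ∸ a) * suc (suc n)               ≡⟨ *-distribʳ-∸ (suc (suc n)) b a ⟩
    b * suc (suc n) ∸ a * suc (suc n)   ≡⟨ cong₂ _∸_ (*-comm b (suc (suc n))) (trans (*-comm a (suc (suc n))) absorb) ⟩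
    b + suc n * b ∸ suc n * b           ≡⟨ m+n∸n≡m b (suc n * b) ⟩
    b                                   ∎)
    where
    open ≡-Reasoning
    b = (suc n + suc n) C suc n
    a = (suc (suc n) + n) C suc (suc n)
    absorb : suc (suc n) * a ≡ suc n * b
    absorb = trans (sucˡ-C (suc n) n) (sym (sucʳ-C (suc n) n))

  -- Divisibility makes the rounded quotient in `catalan` exact. For general `n`, this equation
  -- stands in for the definition from here on.
  suc-*-catalan : ∀ n → suc n * catalan n ≡ (n + n) C n
  suc-*-catalan n with centralBinomial-multiple n
  ... | c , eq = begin
    suc n * catalan n                     ≡⟨ cong (λ m → suc n * ((m C n) / suc n)) (cong (n +_) (+-identityʳ n)) ⟩
    suc n * (((n + n) C n) / suc n)       ≡⟨ cong (λ m → suc n * (m / suc n)) eq ⟩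
    suc n * ((c * suc n) / suc n)         ≡⟨ cong (suc n *_) (m*n/n≡m c (suc n)) ⟩
    suc n * c                             ≡⟨ *-comm (suc n) c ⟩
    c * suc n                             ≡⟨ eq ⟨
    (n + n) C n                           ∎
    where open ≡-Reasoning

  -- Apart from the value at 0, this is all that the convolution formula needs to know about the
  -- closed form.
  catalan-suc : ∀ n → suc (suc n) * catalan (suc n) ≡ (4 * n + 2) * catalan n
  catalan-suc n = *-cancelˡ-≡ _ _ (suc n) (begin
    suc n * (suc (suc n) * catalan (suc n))   ≡⟨ cong (suc n *_) (suc-*-catalan (suc n)) ⟩
    suc n * ((suc n + suc n) C suc n)         ≡⟨ centralBinomial-suc n ⟩
    (4 * n + 2) * ((n + n) C n)               ≡⟨ cong ((4 * n + 2) *_) (suc-*-catalan n) ⟨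
    (4 * n + 2) * (suc n * catalan n)         ≡⟨ exchange (4 * n + 2) (suc n) _ ⟩
    suc n * ((4 * n + 2) * catalan n)         ∎)
    where
    open ≡-Reasoning
    exchange : ∀ a b c → a * (b * c) ≡ b * (a * c)
    exchange = solve-∀

  sumTo-cong : ∀ n {f g : ℕ → ℕ} → (∀ k → k ≤ n → f k ≡ g k) → sumTo n f ≡ sumTo n g
  sumTo-cong zero    f≗g = f≗g 0 z≤n
  sumTo-cong (suc n) f≗g =
    cong₂ _+_ (sumTo-cong n λ k k≤n → f≗g k (m≤n⇒m≤1+n k≤n)) (f≗g (suc n) ≤-refl)

  sumTo-+ : ∀ n (f g : ℕ → ℕ) → sumTo n (λ k → f k + g k) ≡ sumTo n f + sumTo n g
  sumTo-+ zero    f g = refl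
  sumTo-+ (suc n) f g =
    trans (cong (_+ (f (suc n) + g (suc n))) (sumTo-+ n f g)) (exchange (sumTo n f) (sumTo n g) (f (suc n)) (g (suc n)))
    where
    exchange : ∀ a b c d → (a + b) + (c + d) ≡ (a + c) + (b + d)
    exchange = solve-∀

  sumTo-* : ∀ n c (f : ℕ → ℕ) → sumTo n (λ k → c * f k) ≡ c * sumTo n f
  sumTo-* zero    c f = refl
  sumTo-* (suc n) c f =
    trans (cong (_+ c * f (suc n)) (sumTo-* n c f)) (sym (*-distribˡ-+ c _ _))

  sumTo-first : ∀ n (f : ℕ → ℕ) → sumTo (suc n) f ≡ f 0 + sumTo n (λ k → f (suc k))
  sumTo-first zero    f = refl
  sumTo-first (suc n) f =
    trans (cong (_+ f (suc (suc n))) (sumTo-first n f)) (+-assoc (f 0) _ _)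

  sumTo-reverse : ∀ n (f : ℕ → ℕ) → sumTo n f ≡ sumTo n (λ k → f (n ∸ k))
  sumTo-reverse zero    f = refl
  sumTo-reverse (suc n) f = begin
    sumTo n f + f (suc n)                     ≡⟨ +-comm (sumTo n f) _ ⟩
    f (suc n) + sumTo n f                     ≡⟨ cong (f (suc n) +_) (sumTo-reverse n f) ⟩
    f (suc n) + sumTo n (λ k → f (n ∸ k))     ≡⟨ sumTo-first n (λ k → f (suc n ∸ k)) ⟨
    sumTo (suc n) (λ k → f (suc n ∸ k))       ∎
    where open ≡-Reasoning

  sumTo-zero : ∀ n {f : ℕ → ℕ} → (∀ k → k ≤ n → f k ≡ 0) → sumTo n f ≡ 0
  sumTo-zero n f≗0 = trans (sumTo-cong n f≗0) (sumTo-* n 0 (λ _ → 0))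

  catalanConv : ℕ → ℕ
  catalanConv n = sumTo n λ k → catalan k * catalan (n ∸ k)

  -- Reversing the sum replaces the weight k by its mean n / 2.
  catalanConv-weighted : ∀ n → 2 * sumTo n (λ k → k * (catalan k * catalan (n ∸ k))) ≡ n * catalanConv n
  catalanConv-weighted n = begin
    2 * W                                               ≡⟨ double W ⟩
    W + W                                               ≡⟨ cong (W +_) (trans (sumTo-reverse n w) (sumTo-cong n reflect)) ⟩
    W + sumTo n (λ k → (n ∸ k) * c k)                   ≡⟨ sumTo-+ n w (λ k → (n ∸ k) * c k) ⟨
    sumTo n (λ k → k * c k + (n ∸ k) * c k)             ≡⟨ sumTo-cong n (λ k k≤n →
                                                             trans (sym (*-distribʳ-+ (c k) k (n ∸ k))) (cong (_* c k) (m+[n∸m]≡n k≤n))) ⟩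
    sumTo n (λ k → n * c k)                             ≡⟨ sumTo-* n n c ⟩
    n * catalanConv n                                   ∎
    where
    open ≡-Reasoning
    c w : ℕ → ℕ
    c k = catalan k * catalan (n ∸ k)
    w k = k * c k
    W = sumTo n w
    double : ∀ a → 2 * a ≡ a + a
    double = solve-∀
    reflect : ∀ k → k ≤ n → w (n ∸ k) ≡ (n ∸ k) * c k
    reflect k k≤n = cong ((n ∸ k) *_)
      (trans (cong (λ j → catalan (n ∸ k) * catalan j) (m∸[m∸n]≡n k≤n)) (*-comm (catalan (n ∸ k)) _))

  -- With S n = catalanConv n, the sum Σ (k + 1) c_k c_{n+1-k} is (n + 3) / 2 · S (n + 1) by symmetry;
  -- splitting off k = 0 and applying catalan-suc to the rest gives c_{n+1} + 2 (n + 1) S n.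
  catalanConv-rec : ∀ n → (n + 3) * catalanConv (suc n) ≡ 2 * catalan (suc n) + 4 * (n + 1) * catalanConv n
  catalanConv-rec n = begin
    (n + 3) * S′                          ≡⟨ split n S′ ⟩
    suc n * S′ + 2 * S′                   ≡⟨ cong (_+ 2 * S′) (catalanConv-weighted (suc n)) ⟨
    2 * sumTo (suc n) w′ + 2 * S′         ≡⟨ *-distribˡ-+ 2 (sumTo (suc n) w′) S′ ⟨
    2 * (sumTo (suc n) w′ + S′)           ≡⟨ cong (2 *_) (sumTo-+ (suc n) w′ c′) ⟨
    2 * sumTo (suc n) (λ k → w′ k + c′ k) ≡⟨ cong (2 *_) (sumTo-first n (λ k → w′ k + c′ k)) ⟩
    2 * (catalan (suc n) + 0 + sumTo n (λ k → w′ (suc k) + c′ (suc k)))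
                                          ≡⟨ cong₂ (λ a b → 2 * (a + b)) (+-identityʳ (catalan (suc n))) (sumTo-cong n λ k _ → shifted k) ⟩
    2 * (catalan (suc n) + sumTo n (λ k → 4 * w k + 2 * c k))
                                          ≡⟨ cong (λ a → 2 * (catalan (suc n) + a)) (trans (sumTo-+ n _ _)
                                               (cong₂ _+_ (sumTo-* n 4 w) (sumTo-* n 2 c))) ⟩
    2 * (catalan (suc n) + (4 * sumTo n w + 2 * S))
                                          ≡⟨ regroup (catalan (suc n)) (sumTo n w) S ⟩
    2 * catalan (suc n) + 4 * (2 * sumTo n w + S)
                                          ≡⟨ cong (λ a → 2 * catalan (suc n) + 4 * (a + S)) (catalanConv-weighted n) ⟩
    2 * catalan (suc n) + 4 * (n * S + S) ≡⟨ factor n (catalan (suc n)) S ⟩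
    2 * catalan (suc n) + 4 * (n + 1) * S ∎
    where
    open ≡-Reasoning
    S S′ : ℕ
    S = catalanConv n
    S′ = catalanConv (suc n)
    c w c′ w′ : ℕ → ℕ
    c k = catalan k * catalan (n ∸ k)
    w k = k * c k
    c′ k = catalan k * catalan (suc n ∸ k)
    w′ k = k * c′ k
    split : ∀ n s → (n + 3) * s ≡ suc n * s + 2 * s
    split = solve-∀
    regroup : ∀ a b s → 2 * (a + (4 * b + 2 * s)) ≡ 2 * a + 4 * (2 * b + s)
    regroup = solve-∀
    factor : ∀ n a s → 2 * a + 4 * (n * s + s) ≡ 2 * a + 4 * (n + 1) * s
    factor = solve-∀
    collect : ∀ k a b → suc k * (a * b) + a * b ≡ (suc (suc k) * a) * b
    collect = solve-∀
    expand : ∀ k a b → ((4 * k + 2) * a) * b ≡ 4 * (k * (a * b)) + 2 * (a * b)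
    expand = solve-∀
    shifted : ∀ k → w′ (suc k) + c′ (suc k) ≡ 4 * w k + 2 * c k
    shifted k = trans (collect k (catalan (suc k)) (catalan (n ∸ k)))
      (trans (cong (_* catalan (n ∸ k)) (catalan-suc k)) (expand k (catalan k) (catalan (n ∸ k))))

  -- Under the induction hypothesis the right side of `catalanConv-rec` has coefficient 2 + 4(n+1),
  -- the one in `catalan-suc` at `suc n`. Cancelling n+3 finishes.
  catalan-convolution : ∀ n → catalanConv n ≡ catalan (suc n)
  catalan-convolution zero    = refl
  catalan-convolution (suc n) = *-cancelˡ-≡ _ _ (suc (suc (suc n))) (begin
    suc (suc (suc n)) * catalanConv (suc n)               ≡⟨ cong (_* catalanConv (suc n)) (+-comm 3 n) ⟩
    (n + 3) * catalanConv (suc n)                         ≡⟨ catalanConv-rec n ⟩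
    2 * catalan (suc n) + 4 * (n + 1) * catalanConv n     ≡⟨ cong (λ s → 2 * catalan (suc n) + 4 * (n + 1) * s) (catalan-convolution n) ⟩
    2 * catalan (suc n) + 4 * (n + 1) * catalan (suc n)   ≡⟨ collect n (catalan (suc n)) ⟩
    (4 * suc n + 2) * catalan (suc n)                     ≡⟨ catalan-suc (suc n) ⟨
    suc (suc (suc n)) * catalan (suc (suc n))             ∎)
    where
    open ≡-Reasoning
    collect : ∀ n a → 2 * a + 4 * (n + 1) * a ≡ (4 * suc n + 2) * a
    collect = solve-∀

-- Counting with duplicate-free lists: pigeonhole, bijections, disjoint unions.

module Enumeration where

  open import Data.Nat

  -- `key` reads off from an element the block it came from, so blocks with distinct indices are
  -- disjoint.
  concatMap-unique : (F : Y → List X) (key : X → Y) {ys : List Y} → Unique ys →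
    (∀ y → Unique (F y)) → (∀ y {x} → x ∈ F y → key x ≡ y) → Unique (concatMap F ys)
  concatMap-unique F key []         uniqueF keyF = []
  concatMap-unique F key {y ∷ ys} (y∉ys ∷ u) uniqueF keyF =
    Unique.++⁺ (uniqueF y) (concatMap-unique F key u uniqueF keyF) λ (x∈Fy , x∈rest) →
      let y′ , y′∈ys , x∈Fy′ = find (∈-concatMap⁻ F x∈rest)
      in All.lookup y∉ys y′∈ys (trans (sym (keyF y x∈Fy)) (keyF y′ x∈Fy′))

  map-unique : (f : X → Y) {xs : List X} → Unique xs →
    (∀ {x x′} → x ∈ xs → x′ ∈ xs → f x ≡ f x′ → x ≡ x′) → Unique (map f xs)
  map-unique f []          inj = []
  map-unique f {x ∷ xs} (x∉xs ∷ u) inj =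
    All.map⁺ (All.tabulate λ x′∈xs fx≡fx′ → All.lookup x∉xs x′∈xs (inj (here refl) (there x′∈xs) fx≡fx′))
    ∷ map-unique f u λ x∈ x′∈ → inj (there x∈) (there x′∈)

  -- The source of all pigeonhole arguments: each element of `xs` is pulled out of `ys`, and by
  -- uniqueness the remaining ones survive the removal.
  unique-⊆-complement : {xs ys : List X} → Unique xs → (∀ {x} → x ∈ xs → x ∈ ys) →
    ∃ λ zs → ys ↭ xs ++ zs
  unique-⊆-complement {ys = ys} [] xs⊆ys = ys , refl
  unique-⊆-complement {xs = x ∷ xs} (x∉xs ∷ u) xs⊆ys with ∈-∃++ (xs⊆ys (here refl))
  ... | as , bs , refl = _ , ↭-trans (shift x as bs) (prep x (proj₂ (unique-⊆-complement u xs⊆as++bs)))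
    where
    xs⊆as++bs : ∀ {y} → y ∈ xs → y ∈ as ++ bs
    xs⊆as++bs y∈xs with ∈-++⁻ as (xs⊆ys (there y∈xs))
    ... | inj₁ y∈as         = ∈-++⁺ˡ y∈as
    ... | inj₂ (here refl)  = contradiction refl (All.lookup x∉xs y∈xs)
    ... | inj₂ (there y∈bs) = ∈-++⁺ʳ as y∈bs

  unique-⊆-length : {xs ys : List X} → Unique xs → (∀ {x} → x ∈ xs → x ∈ ys) → length xs ≤ length ys
  unique-⊆-length {xs = xs} u xs⊆ys with unique-⊆-complement u xs⊆ys
  ... | zs , ys↭ = subst (length xs ≤_) (sym (↭-length ys↭)) (length-++-≤ˡ xs)

  -- A nonempty complement would make `ys` longer than `xs`. This is the usual way below to obtain
  -- `↭`: one inclusion and a comparison of lengths.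
  unique-⊆-↭ : {xs ys : List X} → Unique xs → (∀ {x} → x ∈ xs → x ∈ ys) →
    length ys ≤ length xs → xs ↭ ys
  unique-⊆-↭ {xs = xs} u xs⊆ys ys≤xs with unique-⊆-complement u xs⊆ys
  ... | []     , ys↭ = ↭-sym (subst (_ ↭_) (++-identityʳ xs) ys↭)
  ... | z ∷ zs , ys↭ = contradiction (subst (_≤ length xs) (trans (↭-length ys↭) (length-++ xs)) ys≤xs)
                                     (m+1+n≰m (length xs))

  -- Injectivity is asked for on members only, because the gluing maps used later are not injective
  -- on arbitrary lists.
  length-bijection : (f : X → Y) {xs : List X} {ys : List Y} → Unique xs → Unique ys →
    (∀ {x x′} → x ∈ xs → x′ ∈ xs → f x ≡ f x′ → x ≡ x′) →
    (∀ {x} → x ∈ xs → f x ∈ ys) → (∀ {y} → y ∈ ys → ∃ λ x → x ∈ xs × f x ≡ y) →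
    length xs ≡ length ys
  length-bijection f {xs} {ys} uniqueXs uniqueYs inj into onto =
    trans (sym (length-map f xs)) (≤-antisym
      (unique-⊆-length (map-unique f uniqueXs inj) λ y∈ → let x , x∈xs , y≡fx = ∈-map⁻ f y∈ in
        subst (_∈ ys) (sym y≡fx) (into x∈xs))
      (unique-⊆-length uniqueYs λ y∈ys → let x , x∈xs , fx≡y = onto y∈ys in
        subst (_∈ map f xs) fx≡y (∈-map⁺ f x∈xs)))

  ↭-++-cancelˡ : {xs xs′ ys ys′ : List X} → xs ↭ xs′ → xs ++ ys ↭ xs′ ++ ys′ → ys ↭ ys′
  ↭-++-cancelˡ {xs = xs} xs↭xs′ p = drop-prefix xs (↭-trans p (↭-++⁺ʳ _ (↭-sym xs↭xs′)))
    where
    drop-prefix : ∀ (ws : List _) {ys ys′} → ws ++ ys ↭ ws ++ ys′ → ys ↭ ys′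
    drop-prefix []       p = p
    drop-prefix (w ∷ ws) p = drop-prefix ws (drop-∷ p)

  unique-resp-↭ : {xs ys : List X} → xs ↭ ys → Unique xs → Unique ys
  unique-resp-↭ {X} p = SetoidPermutation.Unique-resp-↭ (setoid X) (↭⇒↭ₛ p)

  length-cartesianProduct : (xs : List X) (ys : List Y) →
    length (cartesianProduct xs ys) ≡ length xs * length ys
  length-cartesianProduct []       ys = refl
  length-cartesianProduct (x ∷ xs) ys = trans (length-++ (map (x ,_) ys))
    (cong₂ _+_ (length-map (x ,_) ys) (length-cartesianProduct xs ys))

  length-concatMap-upTo : (F : ℕ → List X) → ∀ n →
    length (concatMap F (upTo (suc n))) ≡ sumTo n (length ∘ F)
  length-concatMap-upTo F zero    = cong length (++-identityʳ (F 0))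
  length-concatMap-upTo F (suc n) = begin
    length (concatMap F (upTo (suc (suc n))))                   ≡⟨ cong (length ∘ concatMap F) (upTo-∷ʳ (suc n)) ⟨
    length (concatMap F (upTo (suc n) ++ [ suc n ]))            ≡⟨ cong length (concatMap-++ F (upTo (suc n)) [ suc n ]) ⟩
    length (concatMap F (upTo (suc n)) ++ (F (suc n) ++ []))    ≡⟨ length-++ (concatMap F (upTo (suc n))) ⟩
    length (concatMap F (upTo (suc n))) + length (F (suc n) ++ [])
      ≡⟨ cong₂ _+_ (length-concatMap-upTo F n) (cong length (++-identityʳ (F (suc n)))) ⟩
    sumTo (suc n) (length ∘ F) ∎
    where open ≡-Reasoning

  ∈-concatMap-upTo⁺ : (F : ℕ → List X) → ∀ {k n x} → k ≤ n → x ∈ F k → x ∈ concatMap F (upTo (suc n))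
  ∈-concatMap-upTo⁺ F k≤n x∈ = ∈-concatMap⁺ F (lose (∈-upTo⁺ (s≤s k≤n)) x∈)

  ∈-concatMap-upTo⁻ : (F : ℕ → List X) → ∀ {n x} → x ∈ concatMap F (upTo (suc n)) →
    ∃ λ k → k ≤ n × x ∈ F k
  ∈-concatMap-upTo⁻ F x∈ with find (∈-concatMap⁻ F x∈)
  ... | k , k∈ , x∈Fk = k , s≤s⁻¹ (∈-upTo⁻ k∈) , x∈Fk

-- Permutations of [n] as rearrangements of 1, ..., n, and counts over them.

module Permutations where

  open import Data.Nat
  open import Data.Nat.Tactic.RingSolver using (solve-∀)
  open Enumeration

  ∈-range1⁺ : ∀ {v n} → 1 ≤ v → v ≤ n → v ∈ range1 n
  ∈-range1⁺ (s≤s z≤n) v≤n = ∈-map⁺ suc (∈-upTo⁺ v≤n)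

  ∈-range1⁻ : ∀ {v n} → v ∈ range1 n → 1 ≤ v × v ≤ n
  ∈-range1⁻ v∈ with ∈-map⁻ suc v∈
  ... | _ , u∈ , refl = s≤s z≤n , ∈-upTo⁻ u∈

  length-range1 : ∀ n → length (range1 n) ≡ n
  length-range1 n = trans (length-map suc (upTo n)) (length-upTo n)

  range1-unique : ∀ n → Unique (range1 n)
  range1-unique n = Unique.map⁺ suc-injective (Unique.upTo⁺ n)

  range1-+ : ∀ m n → range1 (m + n) ↭ range1 m ++ map (m +_) (range1 n)
  range1-+ m n = unique-⊆-↭ (range1-unique (m + n)) below
    (≤-reflexive (begin
      length (range1 m ++ map (m +_) (range1 n))             ≡⟨ length-++ (range1 m) ⟩
      length (range1 m) + length (map (m +_) (range1 n))     ≡⟨ cong₂ _+_ (length-range1 m)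
                                                                  (trans (length-map (m +_) (range1 n)) (length-range1 n)) ⟩
      m + n                                                  ≡⟨ length-range1 (m + n) ⟨
      length (range1 (m + n))                                ∎))
    where
    open ≡-Reasoning
    below : ∀ {v} → v ∈ range1 (m + n) → v ∈ range1 m ++ map (m +_) (range1 n)
    below {v} v∈ with v ≤? m
    ... | yes v≤m = ∈-++⁺ˡ (∈-range1⁺ (proj₁ (∈-range1⁻ v∈)) v≤m)
    ... | no  v≰m with m≤n⇒∃[o]m+o≡n (≰⇒> v≰m)
    ... | o , refl = ∈-++⁺ʳ (range1 m) (subst (_∈ map (m +_) (range1 n)) (+-suc m o)
      (∈-map⁺ (m +_) (∈-range1⁺ (s≤s z≤n) (+-cancelˡ-≤ m (suc o) n
        (subst (_≤ m + n) (sym (+-suc m o)) (proj₂ (∈-range1⁻ v∈)))))))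

  elem⇔∈ : ∀ {v} w → T (elem v w) ⇔ v ∈ w
  elem⇔∈ {v} w = mk⇔ (Any.map (≡ᵇ⇒≡ v _) ∘ Any.any⁻ (v ≡ᵇ_) w) (Any.any⁺ (v ≡ᵇ_) ∘ Any.map (≡⇒≡ᵇ v _))

  ∈-words⁻ : ∀ k n {w} → w ∈ words k n → length w ≡ k × All (_∈ range1 n) w
  ∈-words⁻ zero    n (here refl) = refl , []
  ∈-words⁻ (suc k) n w∈ with find (∈-concatMap⁻ (λ v → map (v ∷_) (words k n)) {xs = range1 n} w∈)
  ... | v , v∈ , w∈′ with ∈-map⁻ (v ∷_) w∈′
  ... | u , u∈ , refl with ∈-words⁻ k n u∈
  ... | refl , all∈ = refl , v∈ ∷ all∈

  ∈-words⁺ : ∀ n {w} → All (_∈ range1 n) w → w ∈ words (length w) n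
  ∈-words⁺ n []          = here refl
  ∈-words⁺ n {v ∷ w} (v∈ ∷ all∈) =
    ∈-concatMap⁺ (λ v → map (v ∷_) (words (length w) n)) {xs = range1 n} (lose v∈ (∈-map⁺ (v ∷_) (∈-words⁺ n all∈)))

  words-unique : ∀ k n → Unique (words k n)
  words-unique zero    n = [] ∷ []
  words-unique (suc k) n = concatMap-unique (λ v → map (v ∷_) (words k n)) first (range1-unique n)
    (λ v → Unique.map⁺ ∷-injectiveʳ (words-unique k n))
    (λ v w∈ → let _ , _ , w≡ = ∈-map⁻ (v ∷_) w∈ in cong first w≡)
    where
    first : List ℕ → ℕ
    first []      = 0
    first (v ∷ _) = v

  -- `isPermOf` checks that every value occurs; in a word of length `n` this leaves no room for a
  -- repetition.
  ∈-perms⁻ : ∀ {n w} → w ∈ perms n → w ↭ range1 n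
  ∈-perms⁻ {n} {w} w∈ with ∈-filter⁻ (λ w → T? (isPermOf n w)) w∈
  ... | w∈words , perm = ↭-sym (unique-⊆-↭ (range1-unique n)
    (λ v∈ → to (elem⇔∈ w) (All.lookup (All.all⁺ (λ v → elem v w) (range1 n) perm) v∈))
    (≤-reflexive (trans (proj₁ (∈-words⁻ n n w∈words)) (sym (length-range1 n)))))

  ∈-perms⁺ : ∀ {n w} → w ↭ range1 n → w ∈ perms n
  ∈-perms⁺ {n} {w} w↭ = ∈-filter⁺ (λ w → T? (isPermOf n w))
    (subst (λ k → w ∈ words k n) (trans (↭-length w↭) (length-range1 n)) (∈-words⁺ n (All.tabulate (∈-resp-↭ w↭))))
    (All.all⁻ (λ v → elem v w) (All.tabulate λ v∈ → from (elem⇔∈ w) (∈-resp-↭ (↭-sym w↭) v∈)))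

  perms-unique : ∀ n → Unique (perms n)
  perms-unique n = Unique.filter⁺ (λ w → T? (isPermOf n w)) (words-unique n n)

  perm-length : ∀ {n w} → w ↭ range1 n → length w ≡ n
  perm-length {n} w↭ = trans (↭-length w↭) (length-range1 n)

  perm-bounds : ∀ {n w v} → w ↭ range1 n → v ∈ w → 1 ≤ v × v ≤ n
  perm-bounds w↭ v∈w = ∈-range1⁻ (∈-resp-↭ w↭ v∈w)

  perm-unique : ∀ {n w} → w ↭ range1 n → Unique w
  perm-unique {n} w↭ = unique-resp-↭ (↭-sym w↭) (range1-unique n)

  -- The Iverson bracket. It unfolds to the summand in `des`, and partitions of a count become
  -- pointwise equations between brackets.
  𝟙 : Bool → ℕ
  𝟙 b = if b then 1 else 0

  count-∷ : ∀ (p : List ℕ → Bool) w ws → count p (w ∷ ws) ≡ 𝟙 (p w) + count p ws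
  count-∷ p w ws with p w
  ... | true  = refl
  ... | false = refl

  ∈-count⁻ : ∀ (p : List ℕ → Bool) n {w} → w ∈ filter (λ w → T? (p w)) (perms n) → w ↭ range1 n × T (p w)
  ∈-count⁻ p n w∈ with ∈-filter⁻ (λ w → T? (p w)) w∈
  ... | w∈perms , pw = ∈-perms⁻ w∈perms , pw

  ∈-count⁺ : ∀ (p : List ℕ → Bool) n {w} → w ↭ range1 n → T (p w) → w ∈ filter (λ w → T? (p w)) (perms n)
  ∈-count⁺ p n w↭ pw = ∈-filter⁺ (λ w → T? (p w)) (∈-perms⁺ w↭) pw

  count-unique : ∀ (p : List ℕ → Bool) n → Unique (filter (λ w → T? (p w)) (perms n))
  count-unique p n = Unique.filter⁺ (λ w → T? (p w)) (perms-unique n)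

  count-cong : ∀ {p q : List ℕ → Bool} ws → (∀ {w} → w ∈ ws → p w ≡ q w) → count p ws ≡ count q ws
  count-cong []       p≗q = refl
  count-cong {p} {q} (w ∷ ws) p≗q = trans (count-∷ p w ws)
    (trans (cong₂ (λ b c → 𝟙 b + c) (p≗q (here refl)) (count-cong ws (p≗q ∘ there))) (sym (count-∷ q w ws)))

  count-+ : ∀ {p q r : List ℕ → Bool} → (∀ w → 𝟙 (p w) ≡ 𝟙 (q w) + 𝟙 (r w)) →
    ∀ ws → count p ws ≡ count q ws + count r ws
  count-+ p≗q+r [] = refl
  count-+ {p} {q} {r} p≗q+r (w ∷ ws) = begin
    count p (w ∷ ws)                                      ≡⟨ count-∷ p w ws ⟩
    𝟙 (p w) + count p ws                                  ≡⟨ cong₂ _+_ (p≗q+r w) (count-+ {p} {q} {r} p≗q+r ws) ⟩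
    (𝟙 (q w) + 𝟙 (r w)) + (count q ws + count r ws)       ≡⟨ interchange (𝟙 (q w)) (𝟙 (r w)) (count q ws) (count r ws) ⟩
    (𝟙 (q w) + count q ws) + (𝟙 (r w) + count r ws)       ≡⟨ cong₂ _+_ (count-∷ q w ws) (count-∷ r w ws) ⟨
    count q (w ∷ ws) + count r (w ∷ ws)                   ∎
    where
    open ≡-Reasoning
    open import Data.Nat.Tactic.RingSolver using (solve-∀)
    interchange : ∀ a b c d → (a + b) + (c + d) ≡ (a + c) + (b + d)
    interchange = solve-∀

-- Pattern containment as explicit subsequences.

module Patterns where

  open import Data.Nat

  T-not⇔ : ∀ {b} → T (not b) ⇔ (¬ T b)
  T-not⇔ {true}  = mk⇔ (λ ()) (λ ¬tt → ¬tt _)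
  T-not⇔ {false} = mk⇔ (λ _ ()) (λ _ → _)

  <⇒<ᵇ≡true : ∀ {m n} → m < n → (m <ᵇ n) ≡ true
  <⇒<ᵇ≡true m<n = to T-≡ (<⇒<ᵇ m<n)

  ≤⇒>ᵇ≡false : ∀ {m n} → m ≤ n → (n <ᵇ m) ≡ false
  ≤⇒>ᵇ≡false {m} {n} m≤n = to T-not-≡ (from T-not⇔ λ n<m → <⇒≱ (<ᵇ⇒< n m n<m) m≤n)

  ∈-subseqs⁻ : ∀ k {s xs : List ℕ} → s ∈ subseqs k xs → s ⊆ xs
  ∈-subseqs⁻ zero    (here refl) = minimum _
  ∈-subseqs⁻ (suc k) {xs = x ∷ xs} s∈ with ∈-++⁻ (map (x ∷_) (subseqs k xs)) s∈
  ... | inj₂ s∈′ = x ∷ʳ ∈-subseqs⁻ (suc k) s∈′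
  ... | inj₁ s∈′ with ∈-map⁻ (x ∷_) s∈′
  ... | _ , r∈ , refl = refl ∷ ∈-subseqs⁻ k r∈

  ∈-subseqs⁺ : ∀ {s xs : List ℕ} → s ⊆ xs → s ∈ subseqs (length s) xs
  ∈-subseqs⁺ []              = here refl
  ∈-subseqs⁺ {[]}    (x ∷ʳ p) = here refl
  ∈-subseqs⁺ {y ∷ s} {_ ∷ xs} (x ∷ʳ p) = ∈-++⁺ʳ (map (x ∷_) (subseqs (length s) xs)) (∈-subseqs⁺ p)
  ∈-subseqs⁺ (refl ∷ p)      = ∈-++⁺ˡ (∈-map⁺ (_ ∷_) (∈-subseqs⁺ p))

  contains⁻ : ∀ τ {π} → T (contains τ π) → ∃ λ s → s ⊆ π × T (orderIso s τ)
  contains⁻ τ {π} c with find (Any.any⁻ (λ s → orderIso s τ) (subseqs (length τ) π) c)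
  ... | s , s∈ , iso = s , ∈-subseqs⁻ (length τ) s∈ , iso

  contains⁺ : ∀ τ {π s} → s ⊆ π → length s ≡ length τ → T (orderIso s τ) → T (contains τ π)
  contains⁺ τ {π} {s} s⊆π len iso = Any.any⁺ (λ s → orderIso s τ)
    (lose (subst (λ k → s ∈ subseqs k π) len (∈-subseqs⁺ s⊆π)) iso)

  -- An inductive mirror of the Boolean test: matching on it against a concrete pattern exposes
  -- every pairwise comparison at once.
  data OrderIso : List ℕ → List ℕ → Set where
    []  : OrderIso [] []
    _∷_ : ∀ {x xs y ys} → Pointwise (λ x′ y′ → T (sameCmp x x′ y y′)) xs ys → OrderIso xs ys →
          OrderIso (x ∷ xs) (y ∷ ys)

  OrderIso-length : ∀ {s τ} → OrderIso s τ → length s ≡ length τ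
  OrderIso-length []       = refl
  OrderIso-length (p ∷ ps) = cong suc (OrderIso-length ps)

  module _ (f : ℕ → ℕ → Bool) where
    -- `zipWith` truncates to the shorter list, so equality of lengths has to be supplied.
    and-zipWith⁻ : ∀ xs ys → length xs ≡ length ys → T (and (zipWith f xs ys)) → Pointwise (λ x y → T (f x y)) xs ys
    and-zipWith⁻ []       []       len h = []
    and-zipWith⁻ (x ∷ xs) (y ∷ ys) len h =
      let fxy , rest = to (T-∧ {f x y} {and (zipWith f xs ys)}) h
      in fxy ∷ and-zipWith⁻ xs ys (suc-injective len) rest

    and-zipWith⁺ : ∀ {xs ys} → Pointwise (λ x y → T (f x y)) xs ys → T (and (zipWith f xs ys))
    and-zipWith⁺ []       = _
    and-zipWith⁺ (p ∷ ps) = from T-∧ (p , and-zipWith⁺ ps)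

  orderIso⁻ : ∀ s τ → T (orderIso s τ) → OrderIso s τ
  orderIso⁻ []       []       _ = []
  orderIso⁻ (x ∷ xs) (y ∷ ys) h =
    let cmp = λ x′ y′ → sameCmp x x′ y y′
        p , q = to (T-∧ {and (zipWith cmp xs ys)} {orderIso xs ys}) h
        iso = orderIso⁻ xs ys q
    in and-zipWith⁻ cmp xs ys (OrderIso-length iso) p ∷ iso

  orderIso⁺ : ∀ {s τ} → OrderIso s τ → T (orderIso s τ)
  orderIso⁺ []       = _
  orderIso⁺ (p ∷ ps) = from T-∧ (and-zipWith⁺ (λ x′ y′ → sameCmp _ x′ _ y′) p , orderIso⁺ ps)

  contains⇔ : ∀ τ {π} → T (contains τ π) ⇔ ∃ λ s → s ⊆ π × OrderIso s τ
  contains⇔ τ = mk⇔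
    (λ c → let s , s⊆π , iso = contains⁻ τ c in s , s⊆π , orderIso⁻ s τ iso)
    (λ (s , s⊆π , iso) → contains⁺ τ s⊆π (OrderIso-length iso) (orderIso⁺ iso))

  sameCmp-< : ∀ {x x′ y y′} → y < y′ → T (sameCmp x x′ y y′) ⇔ x < x′
  sameCmp-< {x} {x′} {y} {y′} y<y′
    rewrite <⇒<ᵇ≡true y<y′ | ≤⇒>ᵇ≡false (<⇒≤ y<y′) = mk⇔ forward backward
    where
    -- After both tests on `y` and `y′` have been rewritten, the comparison has the same normal form
    -- as with the sample values 0 and 1.
    forward : T (sameCmp x x′ 0 1) → x < x′
    forward h with x <ᵇ x′ in eq
    ... | true = <ᵇ⇒< x x′ (from T-≡ eq)
    backward : x < x′ → T (sameCmp x x′ 0 1)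
    backward x<x′ rewrite <⇒<ᵇ≡true x<x′ | ≤⇒>ᵇ≡false (<⇒≤ x<x′) = _

  sameCmp-> : ∀ {x x′ y y′} → y′ < y → T (sameCmp x x′ y y′) ⇔ x′ < x
  sameCmp-> {x} {x′} {y} {y′} y′<y
    rewrite <⇒<ᵇ≡true y′<y | ≤⇒>ᵇ≡false (<⇒≤ y′<y) = mk⇔ forward backward
    where
    forward : T (sameCmp x x′ 1 0) → x′ < x
    forward h with x <ᵇ x′ | x′ <ᵇ x in eq
    ... | false | true = <ᵇ⇒< x′ x (from T-≡ eq)
    backward : x′ < x → T (sameCmp x x′ 1 0)
    backward x′<x rewrite <⇒<ᵇ≡true x′<x | ≤⇒>ᵇ≡false (<⇒≤ x′<x) = _

  -- Each pattern is recorded by the chain of its values in increasing order; the other comparisons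
  -- follow by transitivity.
  Has132 Has213 Has1324 : List ℕ → Set
  Has132 π  = ∃₂ λ a b → ∃ λ c → (a ∷ b ∷ c ∷ []) ⊆ π × a < c × c < b
  Has213 π  = ∃₂ λ a b → ∃ λ c → (a ∷ b ∷ c ∷ []) ⊆ π × b < a × a < c
  Has1324 π = ∃₂ λ a b → ∃₂ λ c d → (a ∷ b ∷ c ∷ d ∷ []) ⊆ π × a < c × c < b × b < d

  private
    module _ {x x′ : ℕ} (y y′ : ℕ) {y<y′ : T (y <ᵇ y′)} where
      -- `y` and `y′` are entries of the pattern. For literals the implicit argument has unit type
      -- and is filled in automatically.
      ↗⁻ : T (sameCmp x x′ y y′) → x < x′
      ↗⁻ = to (sameCmp-< {x} {x′} {y} {y′} (<ᵇ⇒< y y′ y<y′))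
      ↗⁺ : x < x′ → T (sameCmp x x′ y y′)
      ↗⁺ = from (sameCmp-< {x} {x′} {y} {y′} (<ᵇ⇒< y y′ y<y′))
    module _ {x x′ : ℕ} (y y′ : ℕ) {y′<y : T (y′ <ᵇ y)} where
      ↘⁻ : T (sameCmp x x′ y y′) → x′ < x
      ↘⁻ = to (sameCmp-> {x} {x′} {y} {y′} (<ᵇ⇒< y′ y y′<y))
      ↘⁺ : x′ < x → T (sameCmp x x′ y y′)
      ↘⁺ = from (sameCmp-> {x} {x′} {y} {y′} (<ᵇ⇒< y′ y y′<y))

  contains132⇔ : ∀ {π} → T (contains p132 π) ⇔ Has132 π
  contains132⇔ {π} = mk⇔ (unpack ∘ to (contains⇔ p132)) (from (contains⇔ p132) ∘ pack)
    where
    unpack : (∃ λ s → s ⊆ π × OrderIso s p132) → Has132 π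
    unpack (_ , s⊆π , (_ ∷ ac ∷ []) ∷ (bc ∷ []) ∷ [] ∷ []) = _ , _ , _ , s⊆π , ↗⁻ 1 2 ac , ↘⁻ 3 2 bc
    pack : Has132 π → ∃ λ s → s ⊆ π × OrderIso s p132
    pack (_ , _ , _ , s⊆π , a<c , c<b) = _ , s⊆π ,
      (↗⁺ 1 3 (<-trans a<c c<b) ∷ ↗⁺ 1 2 a<c ∷ []) ∷ (↘⁺ 3 2 c<b ∷ []) ∷ [] ∷ []

  contains213⇔ : ∀ {π} → T (contains p213 π) ⇔ Has213 π
  contains213⇔ {π} = mk⇔ (unpack ∘ to (contains⇔ p213)) (from (contains⇔ p213) ∘ pack)
    where
    unpack : (∃ λ s → s ⊆ π × OrderIso s p213) → Has213 π
    unpack (_ , s⊆π , (ab ∷ ac ∷ []) ∷ (_ ∷ []) ∷ [] ∷ []) = _ , _ , _ , s⊆π , ↘⁻ 2 1 ab , ↗⁻ 2 3 ac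
    pack : Has213 π → ∃ λ s → s ⊆ π × OrderIso s p213
    pack (_ , _ , _ , s⊆π , b<a , a<c) = _ , s⊆π ,
      (↘⁺ 2 1 b<a ∷ ↗⁺ 2 3 a<c ∷ []) ∷ (↗⁺ 1 3 (<-trans b<a a<c) ∷ []) ∷ [] ∷ []

  contains1324⇔ : ∀ {π} → T (contains p1324 π) ⇔ Has1324 π
  contains1324⇔ {π} = mk⇔ (unpack ∘ to (contains⇔ p1324)) (from (contains⇔ p1324) ∘ pack)
    where
    unpack : (∃ λ s → s ⊆ π × OrderIso s p1324) → Has1324 π
    unpack (_ , s⊆π , (_ ∷ ac ∷ _ ∷ []) ∷ (bc ∷ bd ∷ []) ∷ (_ ∷ []) ∷ [] ∷ []) =
      _ , _ , _ , _ , s⊆π , ↗⁻ 1 2 ac , ↘⁻ 3 2 bc , ↗⁻ 3 4 bd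
    pack : Has1324 π → ∃ λ s → s ⊆ π × OrderIso s p1324
    pack (_ , _ , _ , _ , s⊆π , a<c , c<b , b<d) = _ , s⊆π ,
      (↗⁺ 1 3 a<b ∷ ↗⁺ 1 2 a<c ∷ ↗⁺ 1 4 (<-trans a<b b<d) ∷ [])
      ∷ (↘⁺ 3 2 c<b ∷ ↗⁺ 3 4 b<d ∷ []) ∷ (↗⁺ 2 4 (<-trans c<b b<d) ∷ []) ∷ [] ∷ []
      where a<b = <-trans a<c c<b

  avoids⇔ : ∀ {τ π} {P : Set} → T (contains τ π) ⇔ P → T (avoids τ π) ⇔ (¬ P)
  avoids⇔ c⇔P = mk⇔ (λ av p → to T-not⇔ av (from c⇔P p)) (λ ¬p → from T-not⇔ (¬p ∘ to c⇔P))

  avoids132⇔ : ∀ {π} → T (avoids p132 π) ⇔ (¬ Has132 π)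
  avoids132⇔ {π} = avoids⇔ {p132} {π} contains132⇔

  avoids213⇔ : ∀ {π} → T (avoids p213 π) ⇔ (¬ Has213 π)
  avoids213⇔ {π} = avoids⇔ {p213} {π} contains213⇔

  avoids1324⇔ : ∀ {π} → T (avoids p1324 π) ⇔ (¬ Has1324 π)
  avoids1324⇔ {π} = avoids⇔ {p1324} {π} contains1324⇔

  ⊆-++⁻ : ∀ {s : List ℕ} xs {ys} → s ⊆ xs ++ ys → ∃₂ λ s₁ s₂ → s ≡ s₁ ++ s₂ × s₁ ⊆ xs × s₂ ⊆ ys
  ⊆-++⁻ []       s⊆ = [] , _ , refl , [] , s⊆
  ⊆-++⁻ (x ∷ xs) (.x ∷ʳ s⊆) with ⊆-++⁻ xs s⊆
  ... | s₁ , s₂ , eq , p , q = s₁ , s₂ , eq , x ∷ʳ p , q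
  ⊆-++⁻ (x ∷ xs) (refl ∷ s⊆) with ⊆-++⁻ xs s⊆
  ... | s₁ , s₂ , eq , p , q = x ∷ s₁ , s₂ , cong (x ∷_) eq , refl ∷ p , q

  ⊆-map⁻ : ∀ (f : ℕ → ℕ) {s} xs → s ⊆ map f xs → ∃ λ r → s ≡ map f r × r ⊆ xs
  ⊆-map⁻ f []       []          = [] , refl , []
  ⊆-map⁻ f (x ∷ xs) (_ ∷ʳ s⊆) with ⊆-map⁻ f xs s⊆
  ... | r , eq , r⊆ = r , eq , x ∷ʳ r⊆
  ⊆-map⁻ f (x ∷ xs) (refl ∷ s⊆) with ⊆-map⁻ f xs s⊆
  ... | r , eq , r⊆ = x ∷ r , cong (f x ∷_) eq , refl ∷ r⊆

  has132-⊆ : ∀ {π ρ} → π ⊆ ρ → Has132 π → Has132 ρ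
  has132-⊆ π⊆ρ (a , b , c , s⊆ , lts) = a , b , c , ⊆-trans s⊆ π⊆ρ , lts

  has132-shift⁻ : ∀ k π → Has132 (map (k +_) π) → Has132 π
  has132-shift⁻ k π (_ , _ , _ , s⊆ , a<c , c<b) with ⊆-map⁻ (k +_) π s⊆
  ... | a ∷ b ∷ c ∷ [] , refl , r⊆ = a , b , c , r⊆ , +-cancelˡ-< k _ _ a<c , +-cancelˡ-< k _ _ c<b

  has132-shift⁺ : ∀ k π → Has132 π → Has132 (map (k +_) π)
  has132-shift⁺ k π (_ , _ , _ , s⊆ , a<c , c<b) =
    _ , _ , _ , Sublist.map⁺ (k +_) s⊆ , +-monoʳ-< k a<c , +-monoʳ-< k c<b

  has213-shift⁻ : ∀ k π → Has213 (map (k +_) π) → Has213 π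
  has213-shift⁻ k π (_ , _ , _ , s⊆ , b<a , a<c) with ⊆-map⁻ (k +_) π s⊆
  ... | a ∷ b ∷ c ∷ [] , refl , r⊆ = a , b , c , r⊆ , +-cancelˡ-< k _ _ b<a , +-cancelˡ-< k _ _ a<c

  has213-shift⁺ : ∀ k π → Has213 π → Has213 (map (k +_) π)
  has213-shift⁺ k π (_ , _ , _ , s⊆ , b<a , a<c) =
    _ , _ , _ , Sublist.map⁺ (k +_) s⊆ , +-monoʳ-< k b<a , +-monoʳ-< k a<c

  -- The cases are the number of the four entries lying in `xs`. With at most one, the last three
  -- form a 213 in `ys`; with at least three, the first three form a 132 in `xs`. Exactly two would
  -- put the larger `b` on the low side of the smaller `c`.
  has1324-++⁻ : ∀ {xs ys} → (∀ {x y} → x ∈ xs → y ∈ ys → x < y) →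
    Has1324 (xs ++ ys) → Has132 xs ⊎ Has213 ys
  has1324-++⁻ {xs} xs<ys (a , b , c , d , s⊆ , a<c , c<b , b<d) with ⊆-++⁻ xs s⊆
  ... | [] , _ , refl , _ , q = inj₂ (b , c , d , Sublist.∷ˡ⁻ q , c<b , b<d)
  ... | _ ∷ [] , _ , refl , _ , q = inj₂ (b , c , d , q , c<b , b<d)
  ... | _ ∷ _ ∷ [] , _ , refl , p , q =
    contradiction (xs<ys (lookup p (there (here refl))) (lookup q (here refl))) (<-asym c<b)
  ... | _ ∷ _ ∷ _ ∷ [] , _ , refl , p , _ = inj₁ (a , b , c , p , a<c , c<b)
  ... | _ ∷ _ ∷ _ ∷ _ ∷ [] , _ , refl , p , _ = inj₁ (a , b , c , ⊆-trans (Sublist.++⁺ʳ (d ∷ []) ⊆-refl) p , a<c , c<b)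
  ... | _ ∷ _ ∷ _ ∷ _ ∷ _ ∷ _ , _ , () , _

  has1324-++ˡ : ∀ {xs ys} → (∀ {x y} → x ∈ xs → y ∈ ys → x < y) → ys ≢ [] →
    Has132 xs → Has1324 (xs ++ ys)
  has1324-++ˡ {ys = []}    xs<ys ys≢[] _ = contradiction refl ys≢[]
  has1324-++ˡ {ys = y ∷ _} xs<ys ys≢[] (a , b , c , s⊆ , a<c , c<b) =
    a , b , c , y , Sublist.++⁺ s⊆ (refl ∷ minimum _) , a<c , c<b , xs<ys (lookup s⊆ (there (here refl))) (here refl)

  has1324-++ʳ : ∀ {xs ys} → (∀ {x y} → x ∈ xs → y ∈ ys → x < y) → xs ≢ [] →
    Has213 ys → Has1324 (xs ++ ys)
  has1324-++ʳ {[]}     xs<ys xs≢[] _ = contradiction refl xs≢[]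
  has1324-++ʳ {x ∷ xs} xs<ys xs≢[] (a , b , c , s⊆ , b<a , a<c) =
    x , a , b , c , refl ∷ Sublist.++⁺ˡ xs s⊆ , xs<ys (here refl) (lookup s⊆ (there (here refl))) , b<a , a<c

-- Direct sums, indecomposability and the first component.

module DirectSums where

  open import Data.Nat
  open Enumeration
  open Permutations
  open Patterns

  infixl 6 _⊞_

  -- The direct sum of permutations; the symbol `_⊕_` already denotes addition of power series.
  _⊞_ : List ℕ → List ℕ → List ℕ
  α ⊞ β = α ++ map (length α +_) β

  -- The second part is kept as a raw suffix. That it is a shifted permutation is recovered by
  -- `perm-split` once the whole list is known to be a permutation.
  Decomposition : List ℕ → Set
  Decomposition π = ∃₂ λ α β → π ≡ α ++ β × α ≢ [] × β ≢ [] × α ↭ range1 (length α)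

  private
    ¬T-not : ∀ {b} → ¬ T (not b) → T b
    ¬T-not {true}  _  = _
    ¬T-not {false} ¬t = ¬t _

  prefixIsInitial⁻ : ∀ i π → i ≤ length π → T (prefixIsInitial i π) → take i π ↭ range1 i
  prefixIsInitial⁻ i π i≤ h = ↭-sym (unique-⊆-↭ (range1-unique i)
    (λ v∈ → to (elem⇔∈ (take i π)) (All.lookup (All.all⁺ (λ v → elem v (take i π)) (range1 i) (proj₂
      (to (T-∧ {all (λ v → elem v (range1 i)) (take i π)} {all (λ v → elem v (take i π)) (range1 i)}) h))) v∈))
    (≤-reflexive (trans (length-take i π) (trans (m≤n⇒m⊓n≡m i≤) (sym (length-range1 i))))))

  take-length-++ : ∀ (α β : List ℕ) → take (length α) (α ++ β) ≡ α
  take-length-++ []      β = refl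
  take-length-++ (a ∷ α) β = cong (a ∷_) (take-length-++ α β)

  prefixIsInitial⁺ : ∀ α β → α ↭ range1 (length α) → T (prefixIsInitial (length α) (α ++ β))
  prefixIsInitial⁺ α β α↭ rewrite take-length-++ α β = from T-∧
    ( All.all⁻ (λ v → elem v (range1 (length α))) (All.tabulate λ v∈ → from (elem⇔∈ (range1 (length α))) (∈-resp-↭ α↭ v∈))
    , All.all⁻ (λ v → elem v α) (All.tabulate λ v∈ → from (elem⇔∈ α) (∈-resp-↭ (↭-sym α↭) v∈)))

  indec⇒¬decomposition : ∀ {π} → T (indec π) → ¬ Decomposition π
  indec⇒¬decomposition ind ([]    , β , refl , α≢[] , _) = α≢[] refl
  indec⇒¬decomposition ind (a ∷ α , [] , refl , _ , β≢[] , _) = β≢[] refl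
  indec⇒¬decomposition ind (a ∷ α , β@(b ∷ β′) , refl , _ , _ , α↭) =
    -- `indec` tests the cut positions from 1 to one less than the total length; since `β` is
    -- nonempty, `length (a ∷ α)` is among them.
    to T-not⇔ ind (Any.any⁺ (λ i → prefixIsInitial i (a ∷ α ++ β))
      (lose (∈-range1⁺ (s≤s z≤n) (subst (length (a ∷ α) ≤_) (sym (length-++-sucʳ α b β′)) (s≤s (length-++-≤ˡ α))))
        (prefixIsInitial⁺ (a ∷ α) β α↭)))

  ¬indec⇒decomposition : ∀ {π} → π ≢ [] → ¬ T (indec π) → Decomposition π
  ¬indec⇒decomposition {[]}    π≢[] _ = contradiction refl π≢[]
  ¬indec⇒decomposition {x ∷ π} _ ¬ind with find (Any.any⁻ (λ i → prefixIsInitial i (x ∷ π)) (range1 (length π)) (¬T-not ¬ind))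
  ... | i , i∈ , initial with ∈-range1⁻ i∈
  ... | 1≤i@(s≤s z≤n) , i≤ = take i (x ∷ π) , drop i (x ∷ π) , sym (take++drop≡id i (x ∷ π)) , (λ ()) , drop≢[] {i} {x} i≤ ,
    subst (λ k → take i (x ∷ π) ↭ range1 k) (sym (trans (length-take i (x ∷ π)) (m≤n⇒m⊓n≡m (m≤n⇒m≤1+n i≤))))
      (prefixIsInitial⁻ i (x ∷ π) (m≤n⇒m≤1+n i≤) initial)
    where
    drop≢[] : ∀ {i} {x : ℕ} {π} → i ≤ length π → drop i (x ∷ π) ≢ []
    drop≢[] {suc i} {π = y ∷ π} (s≤s i≤) = drop≢[] {i} {y} i≤

  -- The empty list is neither indecomposable nor decomposable, so negating `indec` alone would let
  -- it in.
  decomposable : List ℕ → Bool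
  decomposable π = not (null π) ∧ not (indec π)

  decomposable⇔ : ∀ π → T (decomposable π) ⇔ Decomposition π
  decomposable⇔ []      = mk⇔ (λ ()) λ where
    ([]    , _ , _ , α≢[] , _) → α≢[] refl
  decomposable⇔ (x ∷ π) = mk⇔
    (λ ¬ind → ¬indec⇒decomposition (λ ()) (to T-not⇔ ¬ind))
    (λ dec → from T-not⇔ λ ind → indec⇒¬decomposition ind dec)

  -- The first part of a decomposition may decompose again, so the cut is repeated inside it. It
  -- gets strictly shorter each time, whence the recursion on length.
  first-component : ∀ {α} → Acc _<_ (length α) → α ≢ [] → α ↭ range1 (length α) →
    ∃₂ λ α′ γ → α ≡ α′ ++ γ × T (indec α′) × α′ ↭ range1 (length α′)
  first-component {α} (acc rec) α≢[] α↭ with T? (indec α)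
  ... | yes ind = α , [] , sym (++-identityʳ α) , ind , α↭
  ... | no ¬ind with ¬indec⇒decomposition α≢[] ¬ind
  ... | α₁ , []     , refl , α₁≢[] , α₂≢[] , α₁↭ = contradiction refl α₂≢[]
  ... | α₁ , b ∷ α₂ , refl , α₁≢[] , α₂≢[] , α₁↭
    with first-component (rec (subst (length α₁ <_) (sym (length-++-sucʳ α₁ b α₂)) (s≤s (length-++-≤ˡ α₁)))) α₁≢[] α₁↭
  ... | α′ , γ , refl , ind , α′↭ = α′ , γ ++ b ∷ α₂ , ++-assoc α′ γ (b ∷ α₂) , ind , α′↭

  indec⇒≢[] : ∀ {α} → T (indec α) → α ≢ []
  indec⇒≢[] ind refl = ind

  -- Cancelling the values up to `length α` from `range1 n` leaves for `γ` exactly the shifted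
  -- range, and the shift can be undone.
  perm-split : ∀ {n} α {γ} → α ↭ range1 (length α) → α ++ γ ↭ range1 n →
    length α ≤ n × (∃ λ β → γ ≡ map (length α +_) β × β ↭ range1 (n ∸ length α))
  perm-split {n} α {γ} α↭ αγ↭ = k≤n , β , γ≡ , ↭-sym β↭
    where
    k = length α
    k≤n : k ≤ n
    k≤n = subst (k ≤_) (perm-length αγ↭) (length-++-≤ˡ α)
    γ↭ : γ ↭ map (k +_) (range1 (n ∸ k))
    γ↭ = ↭-++-cancelˡ α↭ (↭-trans (subst (λ m → α ++ γ ↭ range1 m) (sym (m+[n∸m]≡n k≤n)) αγ↭) (range1-+ k (n ∸ k)))
    preimage = ↭-map-inv (k +_) (↭-sym γ↭)
    β = proj₁ preimage
    γ≡ = proj₁ (proj₂ preimage)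
    β↭ = proj₂ (proj₂ preimage)

  ⊞-perm : ∀ {m n α β} → α ↭ range1 m → β ↭ range1 n → α ⊞ β ↭ range1 (m + n)
  ⊞-perm {m} {n} α↭ β↭ rewrite perm-length α↭ =
    ↭-trans (↭-++⁺ α↭ (↭-map⁺ (m +_) β↭)) (↭-sym (range1-+ m n))

  ⊞-below : ∀ {m n α β} → α ↭ range1 m → β ↭ range1 n →
    ∀ {x y} → x ∈ α → y ∈ map (length α +_) β → x < y
  ⊞-below α↭ β↭ x∈ y∈ with ∈-map⁻ _ y∈
  ... | z , z∈ , refl rewrite perm-length α↭ =
    ≤-<-trans (proj₂ (perm-bounds α↭ x∈)) (m<m+n _ (proj₁ (perm-bounds β↭ z∈)))

  ++-conflict : ∀ (xs xs′ : List ℕ) {ys ys′} → xs ++ ys ≡ xs′ ++ ys′ →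
    (∃ λ zs → xs′ ≡ xs ++ zs) ⊎ (∃ λ zs → xs ≡ xs′ ++ zs)
  ++-conflict []       xs′ eq = inj₁ (xs′ , refl)
  ++-conflict (x ∷ xs) []  eq = inj₂ (x ∷ xs , refl)
  ++-conflict (x ∷ xs) (x′ ∷ xs′) eq with ∷-injective eq
  ... | refl , eq′ with ++-conflict xs xs′ eq′
  ... | inj₁ (zs , refl) = inj₁ (zs , refl)
  ... | inj₂ (zs , refl) = inj₂ (zs , refl)

  -- If `zs` were nonempty, `α` followed by `zs` would be a decomposition of `α′`.
  indec-prefix : ∀ {α α′ zs} → T (indec α) → α ↭ range1 (length α) → T (indec α′) → α′ ≡ α ++ zs → α ≡ α′
  indec-prefix {α} {zs = []}    ind α↭ ind′ refl = sym (++-identityʳ α)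
  indec-prefix {zs = z ∷ zs} ind α↭ ind′ refl =
    contradiction (_ , _ , refl , indec⇒≢[] ind , (λ ()) , α↭) (indec⇒¬decomposition ind′)

  -- Both first summands are prefixes of the same word, so one extends the other, and
  -- indecomposability of the longer one makes them equal. The second summands then agree because
  -- shifting is injective.
  ⊞-injective : ∀ {α α′ β β′} → T (indec α) → α ↭ range1 (length α) → T (indec α′) → α′ ↭ range1 (length α′) →
    α ⊞ β ≡ α′ ⊞ β′ → (α , β) ≡ (α′ , β′)
  ⊞-injective {α} {α′} ind α↭ ind′ α′↭ eq with same (++-conflict α α′ eq)
    where
    same : (∃ λ zs → α′ ≡ α ++ zs) ⊎ (∃ λ zs → α ≡ α′ ++ zs) → α ≡ α′
    same (inj₁ (zs , α′≡)) = indec-prefix ind α↭ ind′ α′≡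
    same (inj₂ (zs , α≡))  = sym (indec-prefix ind′ α′↭ ind α≡)
  ... | refl = cong (α ,_) (map-injective (+-cancelˡ-≡ (length α) _ _) (++-cancelˡ α _ _ eq))

  map-≡[]⁻ : ∀ {f : ℕ → ℕ} {xs} → map f xs ≡ [] → xs ≡ []
  map-≡[]⁻ {xs = []} _ = refl

  avoids1324-⊞ : ∀ {m n α β} → α ↭ range1 m → β ↭ range1 n → α ≢ [] → β ≢ [] →
    T (avoids p1324 (α ⊞ β)) ⇔ (T (avoids p132 α) × T (avoids p213 β))
  avoids1324-⊞ {α = α} {β} α↭ β↭ α≢[] β≢[] = mk⇔
    (λ av → from (avoids132⇔ {α}) (to (avoids1324⇔ {α ⊞ β}) av ∘ has1324-++ˡ below (β≢[] ∘ map-≡[]⁻)) ,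
            from (avoids213⇔ {β}) (to (avoids1324⇔ {α ⊞ β}) av ∘ has1324-++ʳ below α≢[] ∘ has213-shift⁺ (length α) β))
    (λ (avα , avβ) → from (avoids1324⇔ {α ⊞ β}) λ has → [ to (avoids132⇔ {α}) avα ,
       to (avoids213⇔ {β}) avβ ∘ has213-shift⁻ (length α) β ]′ (has1324-++⁻ below has))
    where
    below : ∀ {x y} → x ∈ α → y ∈ map (length α +_) β → x < y
    below = ⊞-below α↭ β↭

  -- The only new adjacent pair sits at the junction, and it is an ascent.
  des-++ : ∀ α {γ} → (∀ {x y} → x ∈ α → y ∈ γ → x < y) → des (α ++ γ) ≡ des α + des γ
  des-++ []          α<γ = refl
  des-++ (x ∷ [])    {[]}    α<γ = refl
  des-++ (x ∷ [])    {y ∷ γ} α<γ rewrite ≤⇒>ᵇ≡false (<⇒≤ (α<γ {x} {y} (here refl) (here refl))) = refl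
  des-++ (x ∷ y ∷ α) α<γ = trans
    (cong (𝟙 (y <ᵇ x) +_) (des-++ (y ∷ α) (α<γ ∘ there))) (sym (+-assoc (𝟙 (y <ᵇ x)) _ _))

  des-shift : ∀ k β → des (map (k +_) β) ≡ des β
  des-shift k []          = refl
  des-shift k (x ∷ [])    = refl
  des-shift k (x ∷ y ∷ β) = cong₂ (λ b d → 𝟙 b + d) (+-<ᵇ k) (des-shift k (y ∷ β))
    where
    +-<ᵇ : ∀ k → (k + y <ᵇ k + x) ≡ (y <ᵇ x)
    +-<ᵇ zero    = refl
    +-<ᵇ (suc k) = +-<ᵇ k

  des-⊞ : ∀ {m n α β} → α ↭ range1 m → β ↭ range1 n → des (α ⊞ β) ≡ des α + des β
  des-⊞ {α = α} {β} α↭ β↭ = trans (des-++ α (⊞-below α↭ β↭)) (cong (des α +_) (des-shift (length α) β))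

  -- A crude bound suffices: `Aₙ` and `Iₙ` sum over descent numbers up to `n`.
  des≤length : ∀ π → des π ≤ length π
  des≤length []          = z≤n
  des≤length (x ∷ [])    = z≤n
  des≤length (x ∷ y ∷ π) = +-mono-≤ (𝟙≤1 (y <ᵇ x)) (des≤length (y ∷ π))
    where
    𝟙≤1 : ∀ b → 𝟙 b ≤ 1
    𝟙≤1 true  = ≤-refl
    𝟙≤1 false = z≤n

-- Splitting 1324-avoiders at the first component.

module FirstComponent where

  open import Data.Nat
  open CatalanNumbers
  open Enumeration
  open Permutations
  open Patterns
  open DirectSums

  -- Instantiated with d = des for the bivariate identity and with d = 0 for the univariate one.
  module Refined (d : List ℕ → ℕ)
    (d-⊞ : ∀ {m n α β} → α ↭ range1 m → β ↭ range1 n → d (α ⊞ β) ≡ d α + d β) where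

    -- For `d = des` the first two unfold to `A` and `I`, and the third gives the coefficients of
    -- the series of avoiders minus 1, removing the constant term by cases instead of by
    -- subtraction.
    avoiders indecAvoiders positiveAvoiders : List ℕ → ℕ → ℕ → ℕ
    avoiders σ n i = count (λ π → avoids σ π ∧ (d π ≡ᵇ i)) (perms n)
    indecAvoiders σ n i = count (λ π → avoids σ π ∧ indec π ∧ (d π ≡ᵇ i)) (perms n)
    positiveAvoiders σ zero    i = 0
    positiveAvoiders σ (suc n) i = avoiders σ (suc n) i

    private
      leftP rightP : ℕ → List ℕ → Bool
      leftP j π = avoids p132 π ∧ indec π ∧ (d π ≡ᵇ j)
      rightP i π = avoids p213 π ∧ (d π ≡ᵇ i)

      left right : ℕ → ℕ → List (List ℕ)
      left k j = filter (λ π → T? (leftP j π)) (perms k)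
      right zero    i = []
      right (suc m) i = filter (λ π → T? (rightP i π)) (perms (suc m))

      -- Pairs are grouped by the length `k` and the statistic `j` of the first summand, so that the
      -- total length unfolds to the double sum in a product of bivariate series. Both indices can
      -- be read off from the pair, which keeps the groups disjoint.
      pairsOfType : ℕ → ℕ → ℕ → ℕ → List (List ℕ × List ℕ)
      pairsOfType n i k j = cartesianProduct (left k j) (right (n ∸ k) (i ∸ j))

      pairsOfLength : ℕ → ℕ → ℕ → List (List ℕ × List ℕ)
      pairsOfLength n i k = concatMap (pairsOfType n i k) (upTo (suc i))

      pairs : ℕ → ℕ → List (List ℕ × List ℕ)
      pairs n i = concatMap (pairsOfLength n i) (upTo (suc n))

      Left Right : ℕ → ℕ → List ℕ → Set
      Left k j α = α ↭ range1 k × T (avoids p132 α) × T (indec α) × d α ≡ j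
      Right m i β = β ↭ range1 m × β ≢ [] × T (avoids p213 β) × d β ≡ i

      ∈-left : ∀ {k j α} → α ∈ left k j ⇔ Left k j α
      ∈-left {k} {j} {α} = mk⇔ forward λ (α↭ , av , ind , dα) →
        ∈-count⁺ (leftP j) k α↭ (from T-∧ (av , from T-∧ (ind , ≡⇒≡ᵇ (d α) j dα)))
        where
        forward : α ∈ left k j → Left k j α
        forward α∈ with ∈-count⁻ (leftP j) k α∈
        ... | α↭ , p with to (T-∧ {avoids p132 α} {indec α ∧ (d α ≡ᵇ j)}) p
        ... | av , q with to (T-∧ {indec α} {d α ≡ᵇ j}) q
        ... | ind , dα = α↭ , av , ind , ≡ᵇ⇒≡ (d α) j dα

      ∈-right : ∀ {m i β} → β ∈ right m i ⇔ Right m i β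
      ∈-right {zero} = mk⇔ (λ ()) λ (β↭ , β≢[] , _) → contradiction (length-zero (perm-length β↭)) β≢[]
        where
        length-zero : ∀ {β : List ℕ} → length β ≡ 0 → β ≡ []
        length-zero {[]} _ = refl
      ∈-right {suc m} {i} {β} = mk⇔ forward λ (β↭ , _ , av , dβ) →
        ∈-count⁺ (rightP i) (suc m) β↭ (from T-∧ (av , ≡⇒≡ᵇ (d β) i dβ))
        where
        forward : β ∈ right (suc m) i → Right (suc m) i β
        forward β∈ with ∈-count⁻ (rightP i) (suc m) β∈
        ... | β↭ , p with to (T-∧ {avoids p213 β} {d β ≡ᵇ i}) p
        ... | av , dβ = β↭ , (λ { refl → contradiction (perm-length β↭) λ () }) , av , ≡ᵇ⇒≡ (d β) i dβ

      ∈-pairs⁻ : ∀ {n i α β} → (α , β) ∈ pairs n i →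
        ∃₂ λ k j → k ≤ n × j ≤ i × Left k j α × Right (n ∸ k) (i ∸ j) β
      ∈-pairs⁻ {n} {i} αβ∈ with ∈-concatMap-upTo⁻ (pairsOfLength n i) {n} αβ∈
      ... | k , k≤n , αβ∈k with ∈-concatMap-upTo⁻ (pairsOfType n i k) {i} αβ∈k
      ... | j , j≤i , αβ∈kj with ∈-cartesianProduct⁻ (left k j) (right (n ∸ k) (i ∸ j)) αβ∈kj
      ... | α∈ , β∈ = k , j , k≤n , j≤i , to ∈-left α∈ , to ∈-right β∈

      ∈-pairs⁺ : ∀ {n i k j α β} → k ≤ n → j ≤ i → Left k j α → Right (n ∸ k) (i ∸ j) β → (α , β) ∈ pairs n i
      ∈-pairs⁺ {n} {i} {k} k≤n j≤i α∈ β∈ = ∈-concatMap-upTo⁺ (pairsOfLength n i) k≤n (∈-concatMap-upTo⁺ (pairsOfType n i k) j≤i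
        (∈-cartesianProduct⁺ (from ∈-left α∈) (from ∈-right β∈)))

      right-unique : ∀ m i → Unique (right m i)
      right-unique zero    i = []
      right-unique (suc m) i = count-unique (rightP i) (suc m)

      pairs-unique : ∀ n i → Unique (pairs n i)
      pairs-unique n i = concatMap-unique (pairsOfLength n i) (length ∘ proj₁) (Unique.upTo⁺ (suc n))
        (λ k → concatMap-unique (pairsOfType n i k) (d ∘ proj₁) (Unique.upTo⁺ (suc i))
          (λ j → Unique.cartesianProduct⁺ (count-unique (leftP j) k) (right-unique (n ∸ k) (i ∸ j)))
          (λ j αβ∈ → let _ , _ , _ , dα≡j = to (∈-left {k} {j}) (proj₁ (∈-cartesianProduct⁻ (left k j) _ αβ∈)) in dα≡j))
        (λ k αβ∈ → let j , _ , αβ∈kj = ∈-concatMap-upTo⁻ (pairsOfType n i k) {i} αβ∈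
                       α↭ , _ = to (∈-left {k} {j}) (proj₁ (∈-cartesianProduct⁻ (left k j) _ αβ∈kj))
                   in perm-length α↭)

      length-pairs : ∀ n i → length (pairs n i) ≡
        sumTo n (λ k → sumTo i (λ j → indecAvoiders p132 k j * positiveAvoiders p213 (n ∸ k) (i ∸ j)))
      length-pairs n i = trans (length-concatMap-upTo (pairsOfLength n i) n) (sumTo-cong n λ k _ →
        trans (length-concatMap-upTo (pairsOfType n i k) i) (sumTo-cong i λ j _ →
          trans (length-cartesianProduct (left k j) (right (n ∸ k) (i ∸ j)))
            (cong (length (left k j) *_) (length-right (n ∸ k) (i ∸ j)))))
        where
        length-right : ∀ m i → length (right m i) ≡ positiveAvoiders p213 m i
        length-right zero    i = refl
        length-right (suc m) i = refl

      sumP : ℕ → List ℕ → Bool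
      sumP i π = avoids p1324 π ∧ decomposable π ∧ (d π ≡ᵇ i)

      sumP⁺ : ∀ {i} π → T (avoids p1324 π) → T (decomposable π) → T (d π ≡ᵇ i) → T (sumP i π)
      sumP⁺ π av dec stat = from T-∧ (av , from T-∧ (dec , stat))

      sums : ℕ → ℕ → List (List ℕ)
      sums n i = filter (λ π → T? (sumP i π)) (perms n)

      length-self : ∀ {k α} → α ↭ range1 k → α ↭ range1 (length α)
      length-self {k} {α} α↭ = subst (λ m → α ↭ range1 m) (sym (perm-length α↭)) α↭

      ⊞∈sums : ∀ {n i k j α β} → k ≤ n → j ≤ i → Left k j α → Right (n ∸ k) (i ∸ j) β → α ⊞ β ∈ sums n i
      ⊞∈sums {n} {i} {k} {j} {α} {β} k≤n j≤i (α↭ , avα , ind , dα) (β↭ , β≢[] , avβ , dβ) =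
        ∈-count⁺ (sumP i) n perm (sumP⁺ (α ⊞ β) av dec stat)
        where
        perm : α ⊞ β ↭ range1 n
        perm = subst (λ m → α ⊞ β ↭ range1 m) (m+[n∸m]≡n k≤n) (⊞-perm α↭ β↭)
        av : T (avoids p1324 (α ⊞ β))
        av = from (avoids1324-⊞ α↭ β↭ (indec⇒≢[] ind) β≢[]) (avα , avβ)
        dec : T (decomposable (α ⊞ β))
        dec = from (decomposable⇔ (α ⊞ β)) (α , _ , refl , indec⇒≢[] ind , β≢[] ∘ map-≡[]⁻ , length-self α↭)
        stat : T (d (α ⊞ β) ≡ᵇ i)
        stat = ≡⇒≡ᵇ (d (α ⊞ β)) i (trans (d-⊞ α↭ β↭) (trans (cong₂ _+_ dα dβ) (m+[n∸m]≡n j≤i)))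

      -- The cut given by `decomposable⇔` need not be the first one. It is refined to the first
      -- component `α`; the rest `γ` of the old first part joins `b ∷ β₀` to form the shifted second
      -- summand.
      sums⊆⊞ : ∀ {n i π} → π ∈ sums n i → ∃ λ αβ → αβ ∈ pairs n i × uncurry _⊞_ αβ ≡ π
      sums⊆⊞ {n} {i} {π} π∈ with ∈-count⁻ (sumP i) n π∈
      ... | π↭ , p with to (T-∧ {avoids p1324 π} {decomposable π ∧ (d π ≡ᵇ i)}) p
      ... | av , q with to (T-∧ {decomposable π} {d π ≡ᵇ i}) q
      ... | dec , dπ with to (decomposable⇔ π) dec
      ... | _ , [] , _ , _ , β₀≢[] , _ = contradiction refl β₀≢[]
      ... | α₀ , b ∷ β₀ , refl , α₀≢[] , β₀≢[] , α₀↭ with first-component (<-wellFounded _) α₀≢[] α₀↭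
      ... | α , γ , refl , ind , α↭
        with perm-split α α↭ (subst (_↭ range1 n) (++-assoc α γ (b ∷ β₀)) π↭)
      ... | k≤n , β , γ≡ , β↭ = found (trans (++-assoc α γ (b ∷ β₀)) (cong (α ++_) γ≡))
        where
        β≢[] : β ≢ []
        β≢[] β≡[] with () ← ++-conicalʳ γ (b ∷ β₀) (trans γ≡ (cong (map (length α +_)) β≡[]))
        found : (α ++ γ) ++ b ∷ β₀ ≡ α ⊞ β → ∃ λ αβ → αβ ∈ pairs n i × uncurry _⊞_ αβ ≡ (α ++ γ) ++ b ∷ β₀
        found eq = (α , β) , ∈-pairs⁺ k≤n j≤i (α↭ , proj₁ avs , ind , refl) (β↭ , β≢[] , proj₂ avs , dβ) , sym eq
          where
          avs : T (avoids p132 α) × T (avoids p213 β)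
          avs = to (avoids1324-⊞ α↭ β↭ (indec⇒≢[] ind) β≢[]) (subst (T ∘ avoids p1324) eq av)
          dα+dβ : d α + d β ≡ i
          dα+dβ = trans (sym (d-⊞ α↭ β↭)) (trans (cong d (sym eq)) (≡ᵇ⇒≡ (d _) i dπ))
          j≤i : d α ≤ i
          j≤i = subst (d α ≤_) dα+dβ (m≤m+n (d α) (d β))
          dβ : d β ≡ i ∸ d α
          dβ = trans (sym (m+n∸m≡n (d α) (d β))) (cong (_∸ d α) dα+dβ)

      decomposable-count : ∀ n i → length (sums n i) ≡
        sumTo n (λ k → sumTo i (λ j → indecAvoiders p132 k j * positiveAvoiders p213 (n ∸ k) (i ∸ j)))
      decomposable-count n i = trans (sym (length-bijection (uncurry _⊞_) (pairs-unique n i) (count-unique (sumP i) n)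
        injective into (sums⊆⊞ {n} {i}))) (length-pairs n i)
        where
        into : ∀ {αβ} → αβ ∈ pairs n i → uncurry _⊞_ αβ ∈ sums n i
        into αβ∈ = let _ , _ , k≤n , j≤i , α∈ , β∈ = ∈-pairs⁻ {n} {i} αβ∈ in ⊞∈sums k≤n j≤i α∈ β∈
        injective : ∀ {αβ αβ′} → αβ ∈ pairs n i → αβ′ ∈ pairs n i → uncurry _⊞_ αβ ≡ uncurry _⊞_ αβ′ → αβ ≡ αβ′
        injective αβ∈ αβ′∈ =
          let _ , _ , _ , _ , (α↭ , _ , ind , _) , _ = ∈-pairs⁻ {n} {i} αβ∈
              _ , _ , _ , _ , (α′↭ , _ , ind′ , _) , _ = ∈-pairs⁻ {n} {i} αβ′∈
          in ⊞-injective ind (length-self α↭) ind′ (length-self α′↭)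

    -- The contribution of the empty permutation, which becomes the summand 1 of the series
    -- identity.
    empties : ℕ → ℕ → ℕ
    empties n i = count (λ π → null π ∧ (d π ≡ᵇ i)) (perms n)

    -- Avoiders are partitioned into the empty, the indecomposable and the decomposable ones; only
    -- the last class needs a bijection.
    avoiders-decomposition : ∀ n i → avoiders p1324 n i ≡ empties n i + (indecAvoiders p1324 n i +
      sumTo n (λ k → sumTo i (λ j → indecAvoiders p132 k j * positiveAvoiders p213 (n ∸ k) (i ∸ j))))
    avoiders-decomposition n i = trans
      (count-+ {q = λ π → null π ∧ (d π ≡ᵇ i)} {r = nonempty} empty-or-not (perms n))
      (cong (empties n i +_) (trans
        (count-+ {q = λ π → avoids p1324 π ∧ indec π ∧ (d π ≡ᵇ i)} {r = sumP i} indec-or-not (perms n))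
        (cong (indecAvoiders p1324 n i +_) (decomposable-count n i))))
      where
      nonempty : List ℕ → Bool
      nonempty π = avoids p1324 π ∧ not (null π) ∧ (d π ≡ᵇ i)
      empty-or-not : ∀ π → 𝟙 (avoids p1324 π ∧ (d π ≡ᵇ i)) ≡ 𝟙 (null π ∧ (d π ≡ᵇ i)) + 𝟙 (nonempty π)
      empty-or-not []      = sym (+-identityʳ (𝟙 (d [] ≡ᵇ i)))
      empty-or-not (x ∷ π) = refl
      split : ∀ a b c → 𝟙 (a ∧ c) ≡ 𝟙 (a ∧ b ∧ c) + 𝟙 (a ∧ not b ∧ c)
      split false b     c     = refl
      split true  false c     = refl
      split true  true  c     = sym (+-identityʳ (𝟙 c))
      indec-or-not : ∀ π → 𝟙 (nonempty π) ≡ 𝟙 (avoids p1324 π ∧ indec π ∧ (d π ≡ᵇ i)) + 𝟙 (sumP i π)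
      indec-or-not []      = refl
      indec-or-not (x ∷ π) = split (avoids p1324 (x ∷ π)) (indec (x ∷ π)) (d (x ∷ π) ≡ᵇ i)

    empties-suc : ∀ n i → empties (suc n) i ≡ 0
    empties-suc n i = none (filter (λ π → T? (null π ∧ (d π ≡ᵇ i))) (perms (suc n))) (∈-count⁻ _ (suc n))
      where
      none : ∀ ws → (∀ {w} → w ∈ ws → w ↭ range1 (suc n) × T (null w ∧ (d w ≡ᵇ i))) → length ws ≡ 0
      none []             h = refl
      none ([] ∷ ws)      h = contradiction (perm-length (proj₁ (h (here refl)))) λ ()
      none ((_ ∷ _) ∷ ws) h = ⊥-elim (proj₂ (h (here refl)))

-- Counting 132-avoiders and the indecomposable ones among them.

module Avoiders132 where

  open import Data.Nat
  open CatalanNumbers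
  open Enumeration
  open Permutations
  open Patterns
  open DirectSums

  unique-++⁻ʳ : (xs : List X) {ys : List X} → Unique (xs ++ ys) → Unique ys
  unique-++⁻ʳ []       u       = u
  unique-++⁻ʳ (x ∷ xs) (_ ∷ u) = unique-++⁻ʳ xs u

  unique-++-disjoint : (xs : List X) {ys : List X} → Unique (xs ++ ys) → ∀ {x} → x ∈ xs → x ∉ ys
  unique-++-disjoint (x ∷ xs) (x∉ ∷ u) (here refl) x∈ys = All.lookup (All.++⁻ʳ xs x∉) x∈ys refl
  unique-++-disjoint (x ∷ xs) (x∉ ∷ u) (there x∈)  x∈ys = unique-++-disjoint xs u x∈ x∈ys

  range1-suc : ∀ n → range1 (suc n) ↭ suc n ∷ range1 n
  range1-suc n = unique-⊆-↭ (range1-unique (suc n)) below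
    (≤-reflexive (trans (cong suc (length-range1 n)) (sym (length-range1 (suc n)))))
    where
    below : ∀ {v} → v ∈ range1 (suc n) → v ∈ suc n ∷ range1 n
    below v∈ with ∈-range1⁻ v∈
    ... | 1≤v , v≤1+n with m≤n⇒m<n∨m≡n v≤1+n
    ... | inj₁ v<1+n = there (∈-range1⁺ 1≤v (s≤s⁻¹ v<1+n))
    ... | inj₂ refl  = here refl

  insert-max : ∀ {n} xs {ys} → xs ++ ys ↭ range1 n → xs ++ suc n ∷ ys ↭ range1 (suc n)
  insert-max {n} xs {ys} p = ↭-trans (shift (suc n) xs ys) (↭-trans (prep (suc n) p) (↭-sym (range1-suc n)))

  delete-max : ∀ {n} xs {ys} → xs ++ suc n ∷ ys ↭ range1 (suc n) → xs ++ ys ↭ range1 n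
  delete-max {n} xs {ys} p = drop-∷ (↭-trans (↭-sym (shift (suc n) xs ys)) (↭-trans p (range1-suc n)))

  max∈ : ∀ {n π} → π ↭ range1 (suc n) → suc n ∈ π
  max∈ π↭ = ∈-resp-↭ (↭-sym π↭) (∈-range1⁺ (s≤s z≤n) ≤-refl)

  -- With `v` in `ys`, every smaller value is in `ys` too, since the entries of `xs` exceed `v`. So
  -- `ys` has room for 1, ..., `v`, and `v` is at most its length.
  lower-block : ∀ {n} xs {ys} → xs ++ ys ↭ range1 n → (∀ {x y} → x ∈ xs → y ∈ ys → y < x) →
    ys ↭ range1 (length ys)
  lower-block {n} xs {ys} p ys<xs = unique-⊆-↭ (unique-++⁻ʳ xs (perm-unique p)) small
    (≤-reflexive (length-range1 (length ys)))
    where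
    small : ∀ {v} → v ∈ ys → v ∈ range1 (length ys)
    small {v} v∈ = ∈-range1⁺ (proj₁ bounds) (subst (_≤ length ys) (length-range1 v)
      (unique-⊆-length (range1-unique v) down))
      where
      bounds = perm-bounds p (∈-++⁺ʳ xs v∈)
      down : ∀ {u} → u ∈ range1 v → u ∈ ys
      down u∈ with ∈-range1⁻ u∈
      ... | 1≤u , u≤v with ∈-++⁻ xs (∈-resp-↭ (↭-sym p) (∈-range1⁺ 1≤u (≤-trans u≤v (proj₂ bounds))))
      ... | inj₁ u∈xs = contradiction (ys<xs u∈xs v∈) (≤⇒≯ u≤v)
      ... | inj₂ u∈ys = u∈ys

  -- An occurrence inside neither block either uses `m` as its 1 or its 2, which maximality forbids,
  -- or has its 1 in `xs` and its 2 in `ys`, which contradicts `ys` lying below `xs`.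
  has132-around⁻ : ∀ {xs m ys} → (∀ {x y} → x ∈ xs → y ∈ ys → y < x) → (∀ {x} → x ∈ xs ++ ys → x < m) →
    Has132 (xs ++ m ∷ ys) → Has132 xs ⊎ Has132 ys
  has132-around⁻ {xs} ys<xs <m (a , b , c , s⊆ , a<c , c<b) with ⊆-++⁻ xs s⊆
  ... | [] , _ , refl , _ , (_ ∷ʳ q) = inj₂ (a , b , c , q , a<c , c<b)
  ... | [] , _ , refl , _ , (refl ∷ q) =
    contradiction (<m (∈-++⁺ʳ xs (lookup q (there (here refl))))) (<-asym a<c)
  ... | _ ∷ [] , _ , refl , p , q =
    contradiction (ys<xs (lookup p (here refl)) (lookup (Sublist.∷⁻ q) (here refl))) (<-asym a<c)
  ... | _ ∷ _ ∷ [] , _ , refl , p , (_ ∷ʳ q) =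
    contradiction (ys<xs (lookup p (here refl)) (lookup q (here refl))) (<-asym a<c)
  ... | _ ∷ _ ∷ [] , _ , refl , p , (refl ∷ q) =
    contradiction (<m (∈-++⁺ˡ (lookup p (there (here refl))))) (<-asym c<b)
  ... | _ ∷ _ ∷ _ ∷ [] , _ , refl , p , _ = inj₁ (a , b , c , p , a<c , c<b)
  ... | _ ∷ _ ∷ _ ∷ _ ∷ _ , _ , () , _

  -- `m` occurs in neither prefix, so its first occurrence marks the cut in both words.
  around-injective : ∀ {m : ℕ} xs xs′ {ys ys′} → m ∉ xs → m ∉ xs′ →
    xs ++ m ∷ ys ≡ xs′ ++ m ∷ ys′ → xs ≡ xs′ × ys ≡ ys′
  around-injective []       []         m∉ m∉′ refl = refl , refl
  around-injective []       (x ∷ xs′)  m∉ m∉′ refl = contradiction (here refl) m∉′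
  around-injective (x ∷ xs) []         m∉ m∉′ refl = contradiction (here refl) m∉
  around-injective (x ∷ xs) (x′ ∷ xs′) m∉ m∉′ eq with ∷-injective eq
  ... | refl , eq′ with around-injective xs xs′ (m∉ ∘ there) (m∉′ ∘ there) eq′
  ... | refl , refl = refl , refl

  ∈-pair-⊆ : ∀ {x y m} xs {ys : List ℕ} → x ∈ xs → y ∈ ys → (x ∷ m ∷ y ∷ []) ⊆ xs ++ m ∷ ys
  ∈-pair-⊆ xs x∈ y∈ = Sublist.++⁺ (from∈ x∈) (refl ∷ from∈ y∈)

  count132 : ℕ → ℕ
  count132 n = count (avoids p132) (perms n)

  av132s : ℕ → List (List ℕ)
  av132s n = filter (λ π → T? (avoids p132 π)) (perms n)

  -- In a 132-avoider every entry before the maximum exceeds every entry after it.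
  module MaxDecomposition (n : ℕ) where

    -- A skew sum with the maximum inserted between the blocks: the left block is shifted above the
    -- right one.
    glue : List ℕ × List ℕ → List ℕ
    glue (L , R) = map (length R +_) L ++ suc n ∷ R

    splitsAt : ℕ → List (List ℕ × List ℕ)
    splitsAt k = cartesianProduct (av132s k) (av132s (n ∸ k))

    splits : List (List ℕ × List ℕ)
    splits = concatMap splitsAt (upTo (suc n))

    ∈-splits⁻ : ∀ L R → (L , R) ∈ splits → ∃ λ k → k ≤ n ×
      (L ↭ range1 k × T (avoids p132 L)) × (R ↭ range1 (n ∸ k) × T (avoids p132 R))
    ∈-splits⁻ L R LR∈ with ∈-concatMap-upTo⁻ splitsAt {n} LR∈
    ... | k , k≤n , LR∈k with ∈-cartesianProduct⁻ (av132s k) (av132s (n ∸ k)) LR∈k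
    ... | L∈ , R∈ = k , k≤n , ∈-count⁻ (avoids p132) k L∈ , ∈-count⁻ (avoids p132) (n ∸ k) R∈

    splits-unique : Unique splits
    splits-unique = concatMap-unique splitsAt (length ∘ proj₁) (Unique.upTo⁺ (suc n))
      (λ k → Unique.cartesianProduct⁺ (count-unique (avoids p132) k) (count-unique (avoids p132) (n ∸ k)))
      (λ k LR∈ → perm-length (proj₁ (∈-count⁻ (avoids p132) k (proj₁ (∈-cartesianProduct⁻ (av132s k) _ LR∈)))))

    -- Up to reordering, the two blocks are `R ⊞ L`, so the facts about direct sums apply.
    blocks : ∀ L R → (L , R) ∈ splits → map (length R +_) L ++ R ↭ range1 n
    blocks L R LR∈ =
      let k , k≤n , (L↭ , _) , (R↭ , _) = ∈-splits⁻ L R LR∈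
      in ↭-trans (++-comm (map (length R +_) L) R)
           (subst (λ m → R ⊞ L ↭ range1 m) (m∸n+n≡m k≤n) (⊞-perm R↭ L↭))

    max∉ : ∀ L R → (L , R) ∈ splits → suc n ∉ map (length R +_) L
    max∉ L R LR∈ max∈ = contradiction (proj₂ (perm-bounds (blocks L R LR∈) (∈-++⁺ˡ max∈))) 1+n≰n

    glue-injective : ∀ {LR LR′} → LR ∈ splits → LR′ ∈ splits → glue LR ≡ glue LR′ → LR ≡ LR′
    glue-injective {L , R} {L′ , R′} LR∈ LR′∈ eq =
      let left≡ , R≡R′ = around-injective (map (length R +_) L) _ (max∉ L R LR∈) (max∉ L′ R′ LR′∈) eq
      in pair≡ left≡ R≡R′
      where
      pair≡ : ∀ {L L′ R R′} → map (length R +_) L ≡ map (length R′ +_) L′ → R ≡ R′ → (L , R) ≡ (L′ , R′)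
      pair≡ {R = R} left≡ refl = cong (_, R) (map-injective (+-cancelˡ-≡ (length R) _ _) left≡)

    glue∈ : ∀ {LR} → LR ∈ splits → glue LR ∈ av132s (suc n)
    glue∈ {L , R} LR∈ =
      let k , k≤n , (L↭ , avL) , (R↭ , avR) = ∈-splits⁻ L R LR∈
      in ∈-count⁺ (avoids p132) (suc n) (insert-max (map (length R +_) L) (blocks L R LR∈))
           (from (avoids132⇔ {glue (L , R)}) λ has →
             [ to (avoids132⇔ {L}) avL ∘ has132-shift⁻ (length R) L , to (avoids132⇔ {R}) avR ]′
               (has132-around⁻ (λ x∈ y∈ → ⊞-below R↭ L↭ y∈ x∈) (λ x∈ → s≤s (proj₂ (perm-bounds (blocks L R LR∈) x∈))) has))

    unglue : ∀ {π} → π ∈ av132s (suc n) → ∃ λ LR → LR ∈ splits × glue LR ≡ π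
    unglue {π} π∈ with ∈-count⁻ (avoids p132) (suc n) π∈
    ... | π↭ , av with ∈-∃++ (max∈ π↭)
    ... | xs , R , refl = result
      where
      xsR↭ : xs ++ R ↭ range1 n
      xsR↭ = delete-max xs π↭
      R<xs : ∀ {x y} → x ∈ xs → y ∈ R → y < x
      R<xs {x} {y} x∈ y∈ with <-cmp x y
      ... | tri> _ _ y<x = y<x
      ... | tri≈ _ refl _ = contradiction y∈ (unique-++-disjoint xs (perm-unique xsR↭) x∈)
      -- Here `x`, the maximum and `y` would form a 132.
      ... | tri< x<y _ _ = contradiction
        (x , suc n , y , ∈-pair-⊆ xs x∈ y∈ , x<y , s≤s (proj₂ (perm-bounds xsR↭ (∈-++⁺ʳ xs y∈))))
        (to (avoids132⇔ {xs ++ suc n ∷ R}) av)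
      R↭ : R ↭ range1 (length R)
      R↭ = lower-block xs xsR↭ R<xs
      avR : T (avoids p132 R)
      avR = from (avoids132⇔ {R}) (to (avoids132⇔ {xs ++ suc n ∷ R}) av ∘ has132-⊆ (Sublist.++⁺ˡ xs (suc n ∷ʳ ⊆-refl)))
      avxs : ¬ Has132 xs
      avxs = to (avoids132⇔ {xs ++ suc n ∷ R}) av ∘ has132-⊆ (Sublist.++⁺ʳ (suc n ∷ R) ⊆-refl)
      result : ∃ λ LR → LR ∈ splits × glue LR ≡ xs ++ suc n ∷ R
      result =
        let b≤n , L , xs≡ , L↭ = perm-split R R↭ (↭-trans (++-comm R xs) xsR↭)
            avL = avxs ∘ subst Has132 (sym xs≡) ∘ has132-shift⁺ (length R) L
            -- Splits are indexed by the length of `L`, here `n ∸ length R`, so `R` is looked up at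
            -- `n ∸ (n ∸ length R)`.
            R↭′ = subst (λ m → R ↭ range1 m) (sym (m∸[m∸n]≡n b≤n)) R↭
        in (L , R) , ∈-concatMap-upTo⁺ splitsAt (m∸n≤m n (length R)) (∈-cartesianProduct⁺
             (∈-count⁺ (avoids p132) (n ∸ length R) L↭ (from (avoids132⇔ {L}) avL))
             (∈-count⁺ (avoids p132) (n ∸ (n ∸ length R)) R↭′ avR)) , cong (_++ suc n ∷ R) (sym xs≡)

  count132-suc : ∀ n → count132 (suc n) ≡ sumTo n (λ k → count132 k * count132 (n ∸ k))
  count132-suc n = trans (sym (length-bijection glue splits-unique (count-unique (avoids p132) (suc n)) glue-injective glue∈ unglue))
    (trans (length-concatMap-upTo splitsAt n) (sumTo-cong n λ k _ → length-cartesianProduct (av132s k) (av132s (n ∸ k))))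
    where open MaxDecomposition n

  count132≡catalan : ∀ n → count132 n ≡ catalan n
  count132≡catalan n = below n n ≤-refl
    where
    -- Course-of-values induction by way of a bound `m`, since the recurrence refers to all smaller
    -- lengths.
    below : ∀ m n → n ≤ m → count132 n ≡ catalan n
    below m       zero    _         = refl
    below (suc m) (suc n) (s≤s n≤m) = trans (count132-suc n) (trans
      (sumTo-cong n λ k k≤n → cong₂ _*_ (below m k (≤-trans k≤n n≤m)) (below m (n ∸ k) (≤-trans (m∸n≤m n k) n≤m)))
      (catalan-convolution n))

  indec132 : ℕ → ℕ
  indec132 n = count (λ π → avoids p132 π ∧ indec π) (perms n)

  -- A decomposable 132-avoider ends with its maximum: any entry after the maximum would form a 132 with
  -- the maximum and an entry of the first component.
  module DecomposableAvoiders (n : ℕ) where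

    decP : List ℕ → Bool
    decP π = avoids p132 π ∧ decomposable π

    decs : List (List ℕ)
    decs = filter (λ π → T? (decP π)) (perms (suc (suc n)))

    append : List ℕ → List ℕ
    append w = w ++ suc (suc n) ∷ []

    append∈ : ∀ {w} → w ∈ av132s (suc n) → append w ∈ decs
    append∈ {w} w∈ with ∈-count⁻ (avoids p132) (suc n) w∈
    ... | w↭ , av = ∈-count⁺ decP (suc (suc n)) (insert-max w w[]↭)
      (from (T-∧ {avoids p132 (append w)} {decomposable (append w)}) (avw , dec))
      where
      w[]↭ : w ++ [] ↭ range1 (suc n)
      w[]↭ = subst (_↭ range1 (suc n)) (sym (++-identityʳ w)) w↭
      avw : T (avoids p132 (append w))
      -- The case of an empty block after the maximum.
      avw = from (avoids132⇔ {append w}) λ has → [ to (avoids132⇔ {w}) av , (λ { (_ , _ , _ , () , _) }) ]′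
        (has132-around⁻ (λ _ ()) (λ x∈ → s≤s (proj₂ (perm-bounds w[]↭ x∈))) has)
      dec : T (decomposable (append w))
      dec = from (decomposable⇔ (append w)) (w , _ , refl , (λ { refl → contradiction (perm-length w↭) λ () }) , (λ ()) ,
        subst (λ m → w ↭ range1 m) (sym (perm-length w↭)) w↭)

    unappend : ∀ {π} → π ∈ decs → ∃ λ w → w ∈ av132s (suc n) × append w ≡ π
    unappend {π} π∈ with ∈-count⁻ decP (suc (suc n)) π∈
    ... | π↭ , p with to (T-∧ {avoids p132 π} {decomposable π}) p
    ... | av , dec with to (decomposable⇔ π) dec
    ... | [] , _ , _ , α≢[] , _ = contradiction refl α≢[]
    ... | _ , [] , _ , _ , β≢[] , _ = contradiction refl β≢[]
    ... | a ∷ α , b ∷ β , refl , _ , _ , aα↭ with ∈-++⁻ (a ∷ α) (max∈ π↭)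
    -- Entries of the first part are at most its length, which is below the total length because a
    -- nonempty part follows.
    ... | inj₁ max∈α = contradiction
      (subst (_≤ length (a ∷ α)) (trans (sym (perm-length π↭)) (length-++-sucʳ (a ∷ α) b β)) (proj₂ (perm-bounds aα↭ max∈α)))
      (<⇒≱ (s≤s (length-++-≤ˡ (a ∷ α))))
    ... | inj₂ max∈β with perm-split (a ∷ α) aα↭ π↭
    ... | _ , β₀ , bβ≡ , β₀↭ = result (∈-∃++ max∈β)
      where
      result : (∃₂ λ β₁ β₂ → b ∷ β ≡ β₁ ++ suc (suc n) ∷ β₂) →
        ∃ λ w → w ∈ av132s (suc n) × append w ≡ (a ∷ α) ++ b ∷ β
      result (β₁ , [] , eq) = w , ∈-count⁺ (avoids p132) (suc n) w↭
          (from (avoids132⇔ {w}) (to (avoids132⇔ {(a ∷ α) ++ b ∷ β}) av ∘ subst Has132 (sym π≡) ∘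
            has132-⊆ (Sublist.++⁺ʳ _ ⊆-refl))) , sym π≡
        where
        w = (a ∷ α) ++ β₁
        π≡ : (a ∷ α) ++ b ∷ β ≡ append w
        π≡ = trans (cong ((a ∷ α) ++_) eq) (sym (++-assoc (a ∷ α) β₁ _))
        w↭ : w ↭ range1 (suc n)
        w↭ = subst (_↭ range1 (suc n)) (++-identityʳ w) (delete-max w (subst (_↭ range1 (suc (suc n))) π≡ π↭))
      result (β₁ , y ∷ β₂ , eq) = contradiction
        (subst Has132 (sym π≡) (a , suc (suc n) , y , ∈-pair-⊆ w (here refl) (here refl) , a<y , y<max))
        (to (avoids132⇔ {(a ∷ α) ++ b ∷ β}) av)
        where
        w = (a ∷ α) ++ β₁
        π≡ : (a ∷ α) ++ b ∷ β ≡ w ++ suc (suc n) ∷ y ∷ β₂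
        π≡ = trans (cong ((a ∷ α) ++_) eq) (sym (++-assoc (a ∷ α) β₁ _))
        y∈bβ : y ∈ b ∷ β
        y∈bβ = subst (y ∈_) (sym eq) (∈-++⁺ʳ β₁ (there (here refl)))
        a<y : a < y
        a<y = ⊞-below aα↭ β₀↭ (here refl) (subst (y ∈_) bβ≡ y∈bβ)
        y<max : y < suc (suc n)
        y<max = s≤s (proj₂ (perm-bounds (delete-max w (subst (_↭ range1 (suc (suc n))) π≡ π↭)) (∈-++⁺ʳ w (here refl))))

    count-decs : length decs ≡ count132 (suc n)
    count-decs = sym (length-bijection append (count-unique (avoids p132) (suc n)) (count-unique decP (suc (suc n)))
      (λ {w} {w′} _ _ eq → ++-cancelʳ _ w w′ eq) append∈ unappend)

  -- Removing the decomposable avoiders, counted by `count-decs`, from all of them. Lengths start at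
  -- 2 because appending the maximum to the empty permutation gives an indecomposable one.
  indec132-suc-suc : ∀ n → catalan (suc (suc n)) ≡ indec132 (suc (suc n)) + catalan (suc n)
  indec132-suc-suc n = begin
    catalan (suc (suc n))                         ≡⟨ count132≡catalan (suc (suc n)) ⟨
    count132 (suc (suc n))
      ≡⟨ count-+ {r = λ π → avoids p132 π ∧ not (indec π)} (λ π → split (avoids p132 π) (indec π)) (perms (suc (suc n))) ⟩
    indec132 (suc (suc n)) + count (λ π → avoids p132 π ∧ not (indec π)) (perms (suc (suc n)))
      ≡⟨ cong (indec132 (suc (suc n)) +_) (count-cong (perms (suc (suc n))) nonempty) ⟩
    indec132 (suc (suc n)) + length decs          ≡⟨ cong (indec132 (suc (suc n)) +_) (trans count-decs (count132≡catalan (suc n))) ⟩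
    indec132 (suc (suc n)) + catalan (suc n)      ∎
    where
    open ≡-Reasoning
    open DecomposableAvoiders n
    nonempty : ∀ {π} → π ∈ perms (suc (suc n)) → avoids p132 π ∧ not (indec π) ≡ decP π
    nonempty {[]}    π∈ = contradiction (perm-length (∈-perms⁻ {suc (suc n)} π∈)) λ ()
    nonempty {x ∷ π} π∈ = refl
    split : ∀ a b → 𝟙 a ≡ 𝟙 (a ∧ b) + 𝟙 (a ∧ not b)
    split false b     = refl
    split true  false = refl
    split true  true  = refl

-- Counting 213-avoiders by symmetry.

module Avoiders213 where

  open import Data.Nat
  open Enumeration
  open Permutations
  open Patterns
  open Avoiders132

  -- Reversal turns 132 into 231, and complementing the values turns that into 213. On permutations
  -- of [n] the composite is an involution.
  reverseComplement : ℕ → List ℕ → List ℕ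
  reverseComplement n w = reverse (map (suc n ∸_) w)

  reverseComplement-perm : ∀ {n w} → w ↭ range1 n → reverseComplement n w ↭ range1 n
  reverseComplement-perm {n} {w} w↭ = ↭-trans (↭-reverse (map (suc n ∸_) w)) (unique-⊆-↭
    (map-unique (suc n ∸_) (perm-unique w↭) λ x∈ y∈ →
      ∸-cancelˡ-≡ (m≤n⇒m≤1+n (proj₂ (perm-bounds w↭ x∈))) (m≤n⇒m≤1+n (proj₂ (perm-bounds w↭ y∈))))
    bounded
    (≤-reflexive (trans (length-range1 n) (sym (trans (length-map (suc n ∸_) w) (perm-length w↭))))))
    where
    bounded : ∀ {v} → v ∈ map (suc n ∸_) w → v ∈ range1 n
    bounded v∈ with ∈-map⁻ (suc n ∸_) v∈
    ... | u , u∈ , refl with perm-bounds w↭ u∈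
    ... | 1≤u , u≤n = ∈-range1⁺ (m<n⇒0<n∸m (s≤s u≤n)) (∸-monoʳ-≤ (suc n) 1≤u)

  reverseComplement-involutive : ∀ {n w} → w ↭ range1 n → reverseComplement n (reverseComplement n w) ≡ w
  reverseComplement-involutive {n} {w} w↭ = begin
    reverse (map f (reverse (map f w)))     ≡⟨ cong reverse (reverse-map f (map f w)) ⟩
    reverse (reverse (map f (map f w)))     ≡⟨ reverse-involutive (map f (map f w)) ⟩
    map f (map f w)                         ≡⟨ map-∘ w ⟨
    map (f ∘ f) w                           ≡⟨ map-id-local (All.tabulate λ x∈ →
                                                 m∸[m∸n]≡n (m≤n⇒m≤1+n (proj₂ (perm-bounds w↭ x∈)))) ⟩
    w                                       ∎
    where
    open ≡-Reasoning
    f = suc n ∸_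

  reverseComplement-⊆ : ∀ n {a b c w} → (a ∷ b ∷ c ∷ []) ⊆ w →
    (suc n ∸ c ∷ suc n ∸ b ∷ suc n ∸ a ∷ []) ⊆ reverseComplement n w
  reverseComplement-⊆ n s⊆ = Sublist.reverse⁺ (Sublist.map⁺ (suc n ∸_) s⊆)

  -- Truncated subtraction can lose strictness for values above `suc n`; membership in a permutation
  -- of [n] rules such values out.
  complement-< : ∀ {n w x y} → w ↭ range1 n → y ∈ w → x < y → suc n ∸ y < suc n ∸ x
  complement-< w↭ y∈ x<y = ∸-monoʳ-< x<y (m≤n⇒m≤1+n (proj₂ (perm-bounds w↭ y∈)))

  has132⇒has213 : ∀ {n w} → w ↭ range1 n → Has132 w → Has213 (reverseComplement n w)
  has132⇒has213 {n} w↭ (_ , _ , _ , s⊆ , a<c , c<b) = _ , _ , _ , reverseComplement-⊆ n s⊆ ,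
    complement-< w↭ (lookup s⊆ (there (here refl))) c<b , complement-< w↭ (lookup s⊆ (there (there (here refl)))) a<c

  has213⇒has132 : ∀ {n w} → w ↭ range1 n → Has213 w → Has132 (reverseComplement n w)
  has213⇒has132 {n} w↭ (_ , _ , _ , s⊆ , b<a , a<c) = _ , _ , _ , reverseComplement-⊆ n s⊆ ,
    complement-< w↭ (lookup s⊆ (there (there (here refl)))) a<c , complement-< w↭ (lookup s⊆ (here refl)) b<a

  count213 : ℕ → ℕ
  count213 n = count (avoids p213) (perms n)

  count213≡catalan : ∀ n → count213 n ≡ catalan n
  count213≡catalan n = trans (length-bijection (reverseComplement n) (count-unique (avoids p213) n) (count-unique (avoids p132) n)
    injective into onto) (count132≡catalan n)
    where
    rc = reverseComplement n
    av213s = filter (λ π → T? (avoids p213 π)) (perms n)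
    injective : ∀ {w w′} → w ∈ av213s → w′ ∈ av213s → rc w ≡ rc w′ → w ≡ w′
    injective w∈ w′∈ eq = trans (sym (reverseComplement-involutive (proj₁ (∈-count⁻ (avoids p213) n w∈))))
      (trans (cong rc eq) (reverseComplement-involutive (proj₁ (∈-count⁻ (avoids p213) n w′∈))))
    into : ∀ {w} → w ∈ av213s → rc w ∈ av132s n
    into {w} w∈ =
      let w↭ , av = ∈-count⁻ (avoids p213) n w∈
          rcw↭ = reverseComplement-perm w↭
      in ∈-count⁺ (avoids p132) n rcw↭ (from (avoids132⇔ {rc w}) (to (avoids213⇔ {w}) av ∘
           subst Has213 (reverseComplement-involutive w↭) ∘ has132⇒has213 rcw↭))
    onto : ∀ {w} → w ∈ av132s n → ∃ λ w′ → w′ ∈ av213s × rc w′ ≡ w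
    onto {w} w∈ =
      let w↭ , av = ∈-count⁻ (avoids p132) n w∈
          rcw↭ = reverseComplement-perm w↭
      in rc w , ∈-count⁺ (avoids p213) n rcw↭ (from (avoids213⇔ {rc w}) (to (avoids132⇔ {w}) av ∘
           subst Has132 (reverseComplement-involutive w↭) ∘ has213⇒has132 rcw↭)) , reverseComplement-involutive w↭

-- Forgetting descents: convolution identities at q = 1.

module Totals where

  open import Data.Nat
  open import Data.Nat.Tactic.RingSolver using (solve-∀)
  open CatalanNumbers
  open Permutations
  open Patterns
  open DirectSums
  open FirstComponent
  open Avoiders132
  open Avoiders213

  𝟙-point : ∀ {n} b k → k ≤ n → sumTo n (λ i → 𝟙 (b ∧ (k ≡ᵇ i))) ≡ 𝟙 b
  𝟙-point {n}     false k k≤n = sumTo-zero n λ _ _ → refl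
  𝟙-point {zero}  true  zero k≤n = refl
  𝟙-point {suc n} true  k k≤n with m≤n⇒m<n∨m≡n k≤n
  ... | inj₁ k<1+n = cong₂ _+_ (𝟙-point true k (s≤s⁻¹ k<1+n)) (cong 𝟙 (≢⇒≡ᵇ≡false (<⇒≢ k<1+n)))
    where
    ≢⇒≡ᵇ≡false : ∀ {m n} → m ≢ n → (m ≡ᵇ n) ≡ false
    ≢⇒≡ᵇ≡false {m} {n} m≢n = to T-not-≡ (from T-not⇔ (m≢n ∘ ≡ᵇ⇒≡ m n))
  ... | inj₂ refl = cong₂ _+_ (sumTo-zero n λ i i≤n → cong 𝟙 (>⇒≡ᵇ≡false (s≤s i≤n))) (cong 𝟙 (to T-≡ (≡⇒≡ᵇ n n refl)))
    where
    >⇒≡ᵇ≡false : ∀ {m n} → n < m → (m ≡ᵇ n) ≡ false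
    >⇒≡ᵇ≡false {m} {n} n<m = to T-not-≡ (from T-not⇔ λ m≡n → <⇒≢ n<m (sym (≡ᵇ⇒≡ m n m≡n)))

  -- Each word is counted for the single index `i = des w`, and the bound places that index inside
  -- the range of summation.
  sumTo-count-des : ∀ (p : List ℕ → Bool) n ws → (∀ {w} → w ∈ ws → des w ≤ n) →
    sumTo n (λ i → count (λ π → p π ∧ (des π ≡ᵇ i)) ws) ≡ count p ws
  sumTo-count-des p n []       des≤n = sumTo-zero n λ _ _ → refl
  sumTo-count-des p n (w ∷ ws) des≤n = begin
    sumTo n (λ i → count (at i) (w ∷ ws))                             ≡⟨ sumTo-cong n (λ i _ → count-∷ (at i) w ws) ⟩
    sumTo n (λ i → 𝟙 (at i w) + count (at i) ws)                      ≡⟨ sumTo-+ n (λ i → 𝟙 (at i w)) _ ⟩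
    sumTo n (λ i → 𝟙 (at i w)) + sumTo n (λ i → count (at i) ws)
      ≡⟨ cong₂ _+_ (𝟙-point (p w) (des w) (des≤n (here refl))) (sumTo-count-des p n ws (des≤n ∘ there)) ⟩
    𝟙 (p w) + count p ws                                              ≡⟨ count-∷ p w ws ⟨
    count p (w ∷ ws)                                                  ∎
    where
    open ≡-Reasoning
    at : ℕ → List ℕ → Bool
    at i π = p π ∧ (des π ≡ᵇ i)

  perms-des≤ : ∀ n {w} → w ∈ perms n → des w ≤ n
  perms-des≤ n {w} w∈ = subst (des w ≤_) (perm-length (∈-perms⁻ {n} w∈)) (des≤length w)

  Aₙ≡count : ∀ σ n → Aₙ σ n ≡ count (avoids σ) (perms n)
  Aₙ≡count σ n = sumTo-count-des (avoids σ) n (perms n) (perms-des≤ n)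

  Iₙ≡count : ∀ σ n → Iₙ σ n ≡ count (λ π → avoids σ π ∧ indec π) (perms n)
  Iₙ≡count σ n = trans
    (sumTo-cong n λ i _ → count-cong (perms n) λ {w} _ → sym (∧-assoc (avoids σ w) (indec w) (des w ≡ᵇ i)))
    (sumTo-count-des (λ π → avoids σ π ∧ indec π) n (perms n) (perms-des≤ n))

  module Bivariate = Refined des des-⊞
  module Univariate = Refined (λ _ → 0) (λ _ _ → refl)

  catalan⁺ : ℕ → ℕ
  catalan⁺ zero    = 0
  catalan⁺ (suc n) = catalan (suc n)

  -- With `catalan⁺` giving the coefficients of C - 1, these are the coefficients of (C - 1)² and of
  -- I^132 (C - 1).
  catalan⁺Conv mixedConv : ℕ → ℕ
  catalan⁺Conv n = sumTo n λ k → catalan⁺ k * catalan⁺ (n ∸ k)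
  mixedConv n = sumTo n λ k → indec132 k * catalan⁺ (n ∸ k)

  -- Taken from the constant statistic at `i = 0`, where the test on the statistic is true and the
  -- inner sum has one term. This avoids summing the bivariate identity over all descent numbers.
  Aₙ-1324 : ∀ n → Aₙ p1324 (suc n) ≡ Iₙ p1324 (suc n) + mixedConv (suc n)
  Aₙ-1324 n = begin
    Aₙ p1324 m                                                      ≡⟨ Aₙ≡count p1324 m ⟩
    count (avoids p1324) (perms m)                                  ≡⟨ count-cong (perms m) (λ {w} _ → ∧-identityʳ (avoids p1324 w)) ⟨
    avoiders p1324 m 0                                              ≡⟨ avoiders-decomposition m 0 ⟩
    empties m 0 + (indecAvoiders p1324 m 0 + sumTo m convTerm)      ≡⟨ cong (_+ (indecAvoiders p1324 m 0 + sumTo m convTerm)) (empties-suc n 0) ⟩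
    indecAvoiders p1324 m 0 + sumTo m convTerm                      ≡⟨ cong₂ _+_ (trans (indecAvoiders≡ p1324 m) (sym (Iₙ≡count p1324 m)))
                                                                         (sumTo-cong m λ k _ → cong₂ _*_ (indecAvoiders≡ p132 k) (positiveAvoiders≡ (m ∸ k))) ⟩
    Iₙ p1324 m + mixedConv m                                        ∎
    where
    open ≡-Reasoning
    open Univariate
    m = suc n
    convTerm : ℕ → ℕ
    convTerm k = indecAvoiders p132 k 0 * positiveAvoiders p213 (m ∸ k) 0
    indecAvoiders≡ : ∀ σ k → indecAvoiders σ k 0 ≡ count (λ π → avoids σ π ∧ indec π) (perms k)
    indecAvoiders≡ σ k = count-cong (perms k) λ {w} _ → cong (avoids σ w ∧_) (∧-identityʳ (indec w))
    positiveAvoiders≡ : ∀ k → positiveAvoiders p213 k 0 ≡ catalan⁺ k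
    positiveAvoiders≡ zero    = refl
    positiveAvoiders≡ (suc k) =
      trans (count-cong (perms (suc k)) λ {w} _ → ∧-identityʳ (avoids p213 w)) (count213≡catalan (suc k))

  -- Since `catalan⁺ 0` is 0, the formula extends to length 1, where no avoider is decomposable.
  indec132-suc : ∀ n → catalan⁺ (suc n) ≡ indec132 (suc n) + catalan⁺ n
  indec132-suc zero    = refl
  indec132-suc (suc n) = indec132-suc-suc n

  -- Coefficientwise form of I^132 (C − 1) = (1 − x)(C − 1)², using I^132 = (1 − x)(C − 1).
  catalan⁺Conv-suc : ∀ n → catalan⁺Conv (suc n) ≡ mixedConv (suc n) + catalan⁺Conv n
  catalan⁺Conv-suc n = begin
    catalan⁺Conv (suc n)                                                    ≡⟨ sumTo-first n _ ⟩
    sumTo n (λ k → catalan⁺ (suc k) * catalan⁺ (n ∸ k))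
      ≡⟨ sumTo-cong n (λ k _ → trans (cong (_* catalan⁺ (n ∸ k)) (indec132-suc k))
           (*-distribʳ-+ (catalan⁺ (n ∸ k)) (indec132 (suc k)) (catalan⁺ k))) ⟩
    sumTo n (λ k → indec132 (suc k) * catalan⁺ (n ∸ k) + catalan⁺ k * catalan⁺ (n ∸ k))
                                                                            ≡⟨ sumTo-+ n _ _ ⟩
    sumTo n (λ k → indec132 (suc k) * catalan⁺ (n ∸ k)) + catalan⁺Conv n    ≡⟨ cong (_+ catalan⁺Conv n) (sumTo-first n _) ⟨
    mixedConv (suc n) + catalan⁺Conv n                                      ∎
    where open ≡-Reasoning

  -- Coefficientwise form of (C − 1)² = C² − 2 (C − 1) − 1, with C² = (C − 1) / x.
  catalan⁺Conv-catalan : ∀ n → catalan (suc (suc n)) ≡ catalan⁺Conv (suc n) + (catalan (suc n) + catalan (suc n))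
  catalan⁺Conv-catalan n = begin
    catalan (suc m)                             ≡⟨ catalan-convolution m ⟨
    catalanConv m
      ≡⟨ sumTo-cong m (λ k _ → trans (cong₂ _*_ (split k) (split (m ∸ k)))
           (expand (δ k) (catalan⁺ k) (δ (m ∸ k)) (catalan⁺ (m ∸ k)))) ⟩
    sumTo m (λ k → catalan⁺ k * catalan⁺ (m ∸ k) + (δ k * (δ (m ∸ k) + catalan⁺ (m ∸ k)) + δ (m ∸ k) * catalan⁺ k))
                                                ≡⟨ trans (sumTo-+ m _ _) (cong (catalan⁺Conv m +_) (sumTo-+ m _ _)) ⟩
    catalan⁺Conv m + (sumTo m (λ k → δ k * (δ (m ∸ k) + catalan⁺ (m ∸ k))) + sumTo m (λ k → δ (m ∸ k) * catalan⁺ k))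
                                                ≡⟨ cong₂ (λ a b → catalan⁺Conv m + (a + b)) (sumTo-δ m _) reflected ⟩
    catalan⁺Conv m + (catalan m + catalan m)    ∎
    where
    open ≡-Reasoning
    m = suc n
    δ : ℕ → ℕ
    δ zero    = 1
    δ (suc _) = 0
    split : ∀ k → catalan k ≡ δ k + catalan⁺ k
    split zero    = refl
    split (suc k) = refl
    expand : ∀ d a e b → (d + a) * (e + b) ≡ a * b + (d * (e + b) + e * a)
    expand = solve-∀
    sumTo-δ : ∀ n (f : ℕ → ℕ) → sumTo n (λ k → δ k * f k) ≡ f 0
    sumTo-δ zero    f = +-identityʳ (f 0)
    sumTo-δ (suc n) f = trans (cong (_+ 0) (sumTo-δ n f)) (+-identityʳ (f 0))
    reflected : sumTo m (λ k → δ (m ∸ k) * catalan⁺ k) ≡ catalan m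
    reflected = trans (sumTo-reverse m _) (trans
      (sumTo-cong m λ k k≤m → cong (λ j → δ j * catalan⁺ (m ∸ k)) (m∸[m∸n]≡n k≤m)) (sumTo-δ m _))

-- Transfer to integer power series and the final identities.

open CatalanNumbers
open Avoiders132 using (indec132)
open Totals

open import Data.Integer using (ℤ; +_; _+_; _-_; _*_)
import Data.Integer.Properties as ℤ
open import Data.Integer.Tactic.RingSolver using (solve-∀)

sumZ-cong : ∀ n {f g : ℕ → ℤ} → (∀ k → f k ≡ g k) → sumZ n f ≡ sumZ n g
sumZ-cong zero    f≗g = f≗g 0
sumZ-cong (suc n) f≗g = cong₂ _+_ (sumZ-cong n f≗g) (f≗g (suc n))

pos-sumTo : ∀ n (f : ℕ → ℕ) → + sumTo n f ≡ sumZ n (λ k → + f k)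
pos-sumTo zero    f = refl
pos-sumTo (suc n) f = trans (ℤ.pos-+ (sumTo n f) (f (suc n))) (cong (λ x → x + + f (suc n)) (pos-sumTo n f))

-- The natural-number partition matches the right side summand by summand; only here does the
-- removed constant term of the 213 series become a subtraction.
bivariate-identity : ∀ n i → Agf p1324 n i
  ≡ (oneS2 ⊕₂ Igf p1324 ⊕₂ Igf p132 ⊛₂ (Agf p213 ⊖₂ oneS2)) n i
bivariate-identity n i = begin
  + A p1324 n i                                           ≡⟨ cong +_ (avoiders-decomposition n i) ⟩
  + (empties n i ℕ.+ (I p1324 n i ℕ.+ sumTo n rows))      ≡⟨ ℤ.pos-+ (empties n i) _ ⟩
  + empties n i + + (I p1324 n i ℕ.+ sumTo n rows)        ≡⟨ cong₂ _+_ (empties≡oneS2 n i) (ℤ.pos-+ (I p1324 n i) (sumTo n rows)) ⟩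
  oneS2 n i + (+ I p1324 n i + + sumTo n rows)            ≡⟨ ℤ.+-assoc (oneS2 n i) (+ I p1324 n i) (+ sumTo n rows) ⟨
  oneS2 n i + + I p1324 n i + + sumTo n rows              ≡⟨ cong (λ r → oneS2 n i + + I p1324 n i + r) rows≡ ⟩
  (oneS2 ⊕₂ Igf p1324 ⊕₂ Igf p132 ⊛₂ (Agf p213 ⊖₂ oneS2)) n i ∎
  where
  open ≡-Reasoning
  open Bivariate
  row : ℕ → ℕ → ℕ
  row k j = I p132 k j ℕ.* positiveAvoiders p213 (n ∸ k) (i ∸ j)
  rows : ℕ → ℕ
  rows k = sumTo i (row k)
  empties≡oneS2 : ∀ n i → + empties n i ≡ oneS2 n i
  empties≡oneS2 zero    zero    = refl
  empties≡oneS2 zero    (suc i) = refl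
  empties≡oneS2 (suc n) i       = cong +_ (empties-suc n i)
  positive≡ : ∀ m i → + positiveAvoiders p213 m i ≡ (Agf p213 ⊖₂ oneS2) m i
  positive≡ zero    zero    = refl
  positive≡ zero    (suc i) = refl
  positive≡ (suc m) i       = sym (ℤ.+-identityʳ (+ A p213 (suc m) i))
  rows≡ : + sumTo n rows ≡ (Igf p132 ⊛₂ (Agf p213 ⊖₂ oneS2)) n i
  rows≡ = trans (pos-sumTo n rows) (sumZ-cong n λ k → trans (pos-sumTo i (row k)) (sumZ-cong i λ j →
    trans (ℤ.pos-* (I p132 k j) _) (cong (λ x → + I p132 k j * x) (positive≡ (n ∸ k) (i ∸ j)))))

sumZ-first : ∀ n (f : ℕ → ℤ) → sumZ (suc n) f ≡ f 0 + sumZ n (λ k → f (suc k))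
sumZ-first zero    f = refl
sumZ-first (suc n) f = trans (cong (_+ f (suc (suc n))) (sumZ-first n f)) (ℤ.+-assoc (f 0) _ _)

sumZ-head : ∀ n (f : ℕ → ℤ) → (∀ k → f (suc k) ≡ + 0) → sumZ n f ≡ f 0
sumZ-head zero    f f≗0 = refl
sumZ-head (suc n) f f≗0 = trans (cong₂ _+_ (sumZ-head n f f≗0) (f≗0 n)) (ℤ.+-identityʳ (f 0))

-- Only the coefficients 1 and -1 of 1 - x at degrees 0 and 1 contribute to the product sum.
[1-x]⊛-suc : ∀ F n → ((oneS ⊖ xS) ⊛ F) (suc n) ≡ F (suc n) - F n
[1-x]⊛-suc F n = trans (sumZ-first n term) (cong₂ _+_ (ℤ.*-identityˡ (F (suc n)))
  (trans (sumZ-head n (λ k → term (suc k)) λ _ → refl) (ℤ.-1*i≡-i (F n))))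
  where
  term : ℕ → ℤ
  term k = (oneS ⊖ xS) k * F (suc n ∸ k)

[C-1]²≡ : ∀ n → ((Cgf ⊖ oneS) ⊛ (Cgf ⊖ oneS)) n ≡ + catalan⁺Conv n
[C-1]²≡ n = sym (trans (pos-sumTo n _) (sumZ-cong n λ k →
  trans (ℤ.pos-* (catalan⁺ k) (catalan⁺ (n ∸ k))) (cong₂ _*_ (catalan⁺≡ k) (catalan⁺≡ (n ∸ k)))))
  where
  catalan⁺≡ : ∀ k → + catalan⁺ k ≡ (Cgf ⊖ oneS) k
  catalan⁺≡ zero    = refl
  catalan⁺≡ (suc k) = sym (ℤ.+-identityʳ (+ catalan (suc k)))

-- By `catalan⁺Conv-suc`, the coefficient of (1 - x)(C - 1)² is `mixedConv`, the number of
-- decomposable avoiders in `Aₙ-1324`.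
univariate-identity : ∀ n → Igf1 p1324 n
  ≡ (Agf1 p1324 ⊖ oneS ⊖ (oneS ⊖ xS) ⊛ ((Cgf ⊖ oneS) ⊛ (Cgf ⊖ oneS))) n
univariate-identity zero    = refl
univariate-identity (suc n) = sym (begin
  + Aₙ p1324 m - + 0 - ((oneS ⊖ xS) ⊛ F) m                    ≡⟨ cong₂ (λ a b → + a - + 0 - b) (Aₙ-1324 n) ([1-x]⊛-suc F n) ⟩
  + (Iₙ p1324 m ℕ.+ s) - + 0 - (F m - F n)                    ≡⟨ cong₂ (λ a b → a - + 0 - b) (ℤ.pos-+ (Iₙ p1324 m) s)
                                                                   (cong₂ _-_ ([C-1]²≡ m) ([C-1]²≡ n)) ⟩
  + Iₙ p1324 m + + s - + 0 - (+ catalan⁺Conv m - + e)         ≡⟨ cong (λ a → + Iₙ p1324 m + + s - + 0 - (a - + e))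
                                                                   (trans (cong +_ (catalan⁺Conv-suc n)) (ℤ.pos-+ s e)) ⟩
  + Iₙ p1324 m + + s - + 0 - (+ s + + e - + e)                ≡⟨ cancel (+ Iₙ p1324 m) (+ s) (+ e) ⟩
  + Iₙ p1324 m                                                ∎)
  where
  open ≡-Reasoning
  m = suc n
  s e : ℕ
  s = mixedConv m
  e = catalan⁺Conv n
  F : FPS
  F = (Cgf ⊖ oneS) ⊛ (Cgf ⊖ oneS)
  cancel : ∀ i s e → i + s - + 0 - (s + e - e) ≡ i
  cancel = solve-∀

-- Let P_k be the coefficient of (C - 1)² at k. For k ≥ 1, P_k = C_{k+1} - 2C_k, so P_n - P_{n-1} =
-- C_{n+1} - 3C_n + 2C_{n-1}, the source of the constants 3 and 2. The formula fails at k = 0, hence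
-- n ≥ 2.
coefficient-identity : ∀ n → n ≥ 2 → + Iₙ p1324 n
  ≡ + Aₙ p1324 n - + catalan (suc n) + + 3 * + catalan n - + 2 * + catalan (pred n)
coefficient-identity (suc zero) (s≤s ())
coefficient-identity n@(suc (suc m)) _ = sym (begin
  + Aₙ p1324 n - + catalan (suc n) + + 3 * + catalan n - + 2 * + c      ≡⟨ cong₂ (λ a b → a - b + + 3 * + catalan n - + 2 * + c) A≡ C″≡ ⟩
  i + s - (s + e + (+ catalan n + + catalan n)) + + 3 * + catalan n - + 2 * + c
                                                                        ≡⟨ cong (λ a → i + s - (s + e + (a + a)) + + 3 * a - + 2 * + c) C′≡ ⟩
  i + s - (s + e + ((e + (+ c + + c)) + (e + (+ c + + c)))) + + 3 * (e + (+ c + + c)) - + 2 * + c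
                                                                        ≡⟨ cancel i s e (+ c) ⟩
  i                                                                     ∎)
  where
  open ≡-Reasoning
  c : ℕ
  c = catalan (suc m)
  i s e : ℤ
  i = + Iₙ p1324 n
  s = + mixedConv n
  e = + catalan⁺Conv (suc m)
  pos-double : ∀ a b → + (a ℕ.+ (b ℕ.+ b)) ≡ + a + (+ b + + b)
  pos-double a b = trans (ℤ.pos-+ a (b ℕ.+ b)) (cong (λ x → + a + x) (ℤ.pos-+ b b))
  A≡ : + Aₙ p1324 n ≡ i + s
  A≡ = trans (cong +_ (Aₙ-1324 (suc m))) (ℤ.pos-+ (Iₙ p1324 n) (mixedConv n))
  C′≡ : + catalan n ≡ e + (+ c + + c)
  C′≡ = trans (cong +_ (catalan⁺Conv-catalan m)) (pos-double (catalan⁺Conv (suc m)) c)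
  -- Expanding the coefficient of the square at `n` as `s + e` gives this term the same `s` that
  -- occurs in `A≡`, so the two cancel.
  C″≡ : + catalan (suc n) ≡ s + e + (+ catalan n + + catalan n)
  C″≡ = trans (cong +_ (catalan⁺Conv-catalan (suc m))) (trans (pos-double (catalan⁺Conv n) (catalan n))
    (cong (_+ (+ catalan n + + catalan n)) (trans (cong +_ (catalan⁺Conv-suc (suc m))) (ℤ.pos-+ (mixedConv n) (catalan⁺Conv (suc m))))))
  cancel : ∀ i s e c → i + s - (s + e + ((e + (c + c)) + (e + (c + c)))) + + 3 * (e + (c + c)) - + 2 * c ≡ i
  cancel = solve-∀

theorem3p17 : ((n i : ℕ) → Agf p1324 n i
    ≡ (oneS2 ⊕₂ Igf p1324 ⊕₂ Igf p132 ⊛₂ (Agf p213 ⊖₂ oneS2)) n i)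
    × ((n : ℕ) → Igf1 p1324 n
    ≡ (Agf1 p1324 ⊖ oneS ⊖ (oneS ⊖ xS) ⊛ ((Cgf ⊖ oneS) ⊛ (Cgf ⊖ oneS))) n)
    × (Iₙ p1324 1 ≡ 1)
    × ((n : ℕ) → n ≥ 2 → + Iₙ p1324 n
    ≡ + Aₙ p1324 n - + catalan (suc n) + + 3 * + catalan n - + 2 * + catalan (pred n))
theorem3p17 = bivariate-identity , univariate-identity , refl , coefficient-identity
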